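{- Let $n\ge 4$ and let $D$ be a bipartite demand graph with base graph $K_{n,n}$, i.e., $V(D)=V(K_{n,n})$ and every edge of $D$ joins a vertex of one color class of $K_{n,n}$ to a vertex of the other. If $D$ has at most $2n-2$ edges and $\Delta(D)\le n$, then $D$ is resolvable in $K_{n,n}$.
   Context: A demand graph on the vertex set of a simple base graph $G$ is a loopless multigraph $D$ with $V(D)=V(G)$ (parallel edges allowed; edges counted with multiplicity). $D$ is resolvable in $G$ if one can assign to each edge of $D$ (counted with multiplicity) a path in $G$ joining the two endpoints of that edge, such that the assigned paths are pairwise edge-disjoint. $\Delta(D)$ is the maximum degree of $D$, counting edges with multiplicity. -}

module Defs where

open import Data.Nat using (ℕ; _≤_; _∸_; _*_)
open import Data.Fin using (Fin; _≟_)
open import Data.Sum using (_⊎_; inj₁; inj₂)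
open import Data.Product using (_×_; _,_; proj₁; proj₂; Σ)
open import Data.List using (List; []; _∷_; length; filter; lookup)
open import Data.List.Relation.Unary.Unique.Propositional using (Unique)
open import Data.List.Relation.Binary.Disjoint.Propositional using (Disjoint)
open import Relation.Binary.PropositionalEquality using (_≡_; _≢_)

V : ℕ → Set
V n = Fin n ⊎ Fin n

-- An edge of K_{n,n} is identified with the pair (i , j) meaning {inj₁ i, inj₂ j}.
BEdge : ℕ → Set
BEdge n = Fin n × Fin n

data Adj {n : ℕ} : V n → V n → Set where
  lr : (i j : Fin n) → Adj (inj₁ i) (inj₂ j)
  rl : (j i : Fin n) → Adj (inj₂ j) (inj₁ i)

adjEdge : ∀ {n} {u w : V n} → Adj u w → BEdge n
adjEdge (lr i j) = i , j
adjEdge (rl j i) = i , j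

data Walk {n : ℕ} : V n → V n → Set where
  stop : (v : V n) → Walk v v
  step : ∀ {u w v} → Adj u w → Walk w v → Walk u v

verts : ∀ {n} {u v : V n} → Walk u v → List (V n)
verts (stop v) = v ∷ []
verts {u = u} (step a w) = u ∷ verts w

edges : ∀ {n} {u v : V n} → Walk u v → List (BEdge n)
edges (stop v) = []
edges (step a w) = adjEdge a ∷ edges w

record Path {n : ℕ} (u v : V n) : Set where
  constructor mkPath
  field
    walk     : Walk u v
    distinct : Unique (verts walk)
open Path public

-- A bipartite demand graph on V(K_{n,n}): a finite multiset (list, so edges are
-- counted with multiplicity) of demand edges, each (i , j) joining inj₁ i and inj₂ j.
Demand : ℕ → Set
Demand n = List (BEdge n)

deg : ∀ {n} → Demand n → V n → ℕ
deg D (inj₁ i) = length (filter (λ e → proj₁ e ≟ i) D)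
deg D (inj₂ j) = length (filter (λ e → proj₂ e ≟ j) D)

MaxDegLe : ∀ {n} → Demand n → ℕ → Set
MaxDegLe {n} D k = (v : V n) → deg D v ≤ k

Resolvable : ∀ {n} → Demand n → Set
Resolvable {n} D =
  Σ ((k : Fin (length D)) → Path (inj₁ (proj₁ (lookup D k))) (inj₂ (proj₂ (lookup D k))))
    λ P → (k l : Fin (length D)) → k ≢ l → Disjoint (edges (walk (P k))) (edges (walk (P l)))

-- Pad D to exactly 2n - 2 demands and induct on n, deleting r rows and r columns together with
-- 2r demands that are routed through edges at the deleted vertices (r = 1 or 2).  What remains has
-- 2(n - r) - 2 demands, but one vertex per class may exceed the new degree bound n - r; it is
-- lowered by moving demands along a path v - b - c through a deleted vertex b whose edges are
-- still free.  Since the average degree is below 2, each class has a vertex of degree 0 or two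
-- vertices of degree 1.  A vertex of degree 1, or one of degree 2 with two distinct neighbours
-- next to an isolated vertex of the other class, allows r = 1.  Otherwise r = 2: with two isolated
-- vertices in each class four demands are routed through the 4-cycle of these vertices, and with
-- a single isolated vertex in a class all other degrees there are 2, so two double demands are
-- routed.  The order 4, and the order 5 without vertices of degree 1, are settled by an exhaustive
-- search over multiplicity matrices.

{-# OPTIONS --safe #-}
module Submission where

open import Defs
import Data.Fin as Fin
import Data.List.Membership.DecPropositional as DecMembership
open import Data.List.Membership.DecPropositional using () renaming (_∈?_ to mem?)
import Data.List.Relation.Binary.Permutation.Propositional as ↭
import Data.List.Relation.Binary.Permutation.Setoid.Properties as ↭ₛ
import Data.List.Relation.Unary.All as All
import Data.List.Relation.Unary.All.Properties as All
import Data.List.Relation.Unary.AllPairs as AllPairs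
import Data.List.Relation.Unary.Any as Any
import Data.List.Relation.Unary.Any.Properties as Any
import Data.Nat as ℕ
import Data.Product.Properties as Product
import Data.Sum.Properties as Sum
import Relation.Binary.Construct.Flip.EqAndOrd as Flip
import Relation.Binary.Construct.On as On
open import Data.Bool using (Bool; true; false; not; _∧_; _∨_; T)
open import Data.Bool.ListAction using (any; all)
open import Data.Bool.Properties using (T-∧; T-≡)
open import Data.Empty using (⊥-elim)
open import Data.Fin using (Fin; zero; suc; _≟_)
open import Data.List
  using (List; []; _∷_; _++_; map; length; concatMap; replicate; filter; upTo; zipWith; downFrom;
    cartesianProduct; filterᵇ; foldr; lookup; allFin)
open import Data.List.Membership.Propositional using (_∈_; _∉_; find; lose)
open import Data.List.Membership.Propositional.Properties
  using (∈-++⁺ˡ; ∈-++⁺ʳ; ∈-++⁻; ∈-filter⁻; ∈-map⁺; ∈-map⁻; ∈-cartesianProduct⁻; ∈-upTo⁻; ∈-upTo⁺;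
    ∈-concatMap⁺; ∈-allFin; ∈-∃++)
open import Data.List.Properties
  using (++-identityʳ; filter-accept; filter-reject; filter-++; filter-all; length-++; length-map;
    map-++; map-replicate; map-cong; length-tabulate)
open import Data.List.Relation.Binary.Disjoint.Propositional using (Disjoint)
open import Data.List.Relation.Binary.Permutation.Propositional
  using (_↭_; ↭-refl; ↭-sym; ↭-trans; ↭-prep; ↭-reflexive; ↭⇒↭ₛ; module PermutationReasoning)
open import Data.List.Relation.Binary.Permutation.Propositional.Properties
  using (↭-length; filter-↭; ∈-resp-↭; All-resp-↭; shift; ++-comm; ++⁺; ++⁺ˡ; ++⁺ʳ;
    ∷↭∷ʳ) renaming (map⁺ to ↭-map⁺)
open import Data.List.Relation.Unary.All using (All; []; _∷_)
open import Data.List.Relation.Unary.Any using (here; there)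
open import Data.List.Relation.Unary.Linked using (Linked; []; [-]; _∷_)
open import Data.List.Relation.Unary.Unique.Propositional using (Unique; []; _∷_)
open import Data.List.Relation.Unary.Unique.Propositional.Properties using (allFin⁺)
open import Data.List.Sort using (sort; sort-↭; sort-↗)
open import Data.Nat using (ℕ; zero; suc; _+_; _*_; _∸_; _≤_; _<_; z≤n; s≤s; _≡ᵇ_; _≤ᵇ_; _<?_; _≤?_)
open import Data.Nat.ListAction using (sum)
open import Data.Nat.ListAction.Properties using (sum-↭)
open import Data.Nat.Properties hiding (_≟_; _≤?_; _<?_)
open import Data.Nat.Tactic.RingSolver using (solve-∀)
open import Data.Product using (_×_; _,_; proj₁; proj₂; Σ; ∃; ∃₂; swap)
open import Data.Sum using (_⊎_; inj₁; inj₂)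
open import Function using (_∘_; id; case_of_; _∋_)
open import Function.Bundles using (module Equivalence)
open import Relation.Binary.PropositionalEquality
  using (_≡_; _≢_; refl; sym; trans; cong; cong₂; subst; ≢-sym; setoid; module ≡-Reasoning)
open import Relation.Nullary using (¬_; Dec; yes; no)
open import Relation.Nullary.Decidable using (T?; decidable-stable; ¬?; _×-dec_)
open import Relation.Unary using (Decidable)
open Equivalence using (to; from)

-- A vertex `v` that survives a deletion of `r` vertices per class has degree at most `k + r` and
-- has to come down to `k`. Each deleted vertex of the other class can take one demand off `v`,
-- unless its edge to `v` is already occupied. The routings of the deleted demands are designed so
-- that every occupied edge between a deleted and a surviving vertex can be charged to an end of a
-- deleted demand at the survivor, that is, to a degree it has already lost; in the one exception
-- the remaining degrees are at most 2. Moving the row end of a demand changes no column degree, so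
-- the two classes can be lowered one after the other, through disjoint sets of edges. The bound 4 ≤
-- k provides the new end `c` of a moved demand. Order 5 needs its own search because `r` = 2 would
-- lead to order 3.

private variable
  A B X Y : Set
  a c x y z : A
  es : List (A × A)
  N : ℕ

-- Trails and edge-disjoint families of trails

Edge : Set → Set
Edge A = A × A

-- Only walks from a row to a column occur, so they grow by two edges at a time, and every edge is
-- stored as (row , column) whatever the direction of traversal.
data Trail {A : Set} : A → A → List (Edge A) → Set where
  direct : Trail a x ((a , x) ∷ [])
  detour : Trail c x es → Trail a x ((a , y) ∷ (c , y) ∷ es)

detourʳ : Trail a z es → Trail a x (es ++ (c , z) ∷ (c , x) ∷ [])
detourʳ direct     = detour direct
detourʳ (detour t) = detour (detourʳ t)

map-trail : (f g : A → B) → Trail a x es →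
  Trail (f a) (g x) (map (λ e → f (proj₁ e) , g (proj₂ e)) es)
map-trail f g direct     = direct
map-trail f g (detour t) = detour (map-trail f g t)

reverse-trail : Trail a x es → ∃ λ es′ → Trail x a es′ × (∀ {e} → e ∈ es′ → swap e ∈ es)
reverse-trail direct = _ , direct , λ { (here refl) → here refl }
reverse-trail (detour t) with reverse-trail t
... | es′ , t′ , h = _ , detourʳ t′ , λ e∈ → sub (∈-++⁻ es′ e∈)
  where
  sub : ∀ {e} → _ → swap e ∈ _
  sub (inj₁ e∈)                 = there (there (h e∈))
  sub (inj₂ (here refl))         = there (here refl)
  sub (inj₂ (there (here refl))) = here refl

-- The index P loses the edges of each trail, so the trails are pairwise edge-disjoint.  A single
-- trail may repeat an edge; loop erasure turns it into a path at the end.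
data Routed {A : Set} : (Edge A → Set) → List (Edge A) → Set₁ where
  []  : ∀ {P} → Routed P []
  _∷_ : ∀ {P D} → Trail a x es × All P es →
        Routed (λ e → P e × e ∉ es) D → Routed P ((a , x) ∷ D)

weaken : {P Q : Edge A → Set} {D : List (Edge A)} →
  (∀ {e} → P e → Q e) → Routed P D → Routed Q D
weaken sub []             = []
weaken sub ((t , ps) ∷ r) =
  (t , All.map sub ps) ∷ weaken (λ { (p , e∉) → sub p , e∉ }) r

permute : {P : Edge A → Set} {D D′ : List (Edge A)} → D ↭ D′ → Routed P D → Routed P D′
permute ↭.refl         r       = r
permute (↭.prep _ s)   (t ∷ r) = t ∷ permute s r
permute (↭.trans s s′) r       = permute s′ (permute s r)
permute (↭.swap _ _ s) ((t , ps) ∷ (t′ , ps′) ∷ r) =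
  (t′ , All.map proj₁ ps′) ∷
  (t , All.tabulate λ e∈ → All.lookup ps e∈ , λ e∈′ → proj₂ (All.lookup ps′ e∈′) e∈) ∷
  weaken (λ { ((p , e∉) , e∉′) → (p , e∉′) , e∉ }) (permute s r)

append : {P Q : Edge A → Set} {D D′ : List (Edge A)} → (∀ {e} → P e → ¬ Q e) →
  Routed P D → Routed Q D′ → Routed (λ e → P e ⊎ Q e) (D ++ D′)
append disj []             s = weaken inj₂ s
append disj ((t , ps) ∷ r) s =
  (t , All.map inj₁ ps) ∷
  weaken (λ { (inj₁ (p , e∉)) → inj₁ p , e∉
            ; (inj₂ q) → inj₂ q , λ e∈ → disj (All.lookup ps e∈) q })
         (append (disj ∘ proj₁) r s)

-- Injectivity is asked on `P` only: the maps applied later are list lookups, which are injective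
-- just on valid positions.
map-routed : {P : Edge A → Set} {D : List (Edge A)} (f g : A → B) →
  let fg = λ e → f (proj₁ e) , g (proj₂ e) in
  (∀ {e e′} → P e → P e′ → fg e ≡ fg e′ → e ≡ e′) →
  Routed P D → Routed (λ e → ∃ λ e′ → P e′ × e ≡ fg e′) (map fg D)
map-routed f g inj []             = []
map-routed f g inj ((t , ps) ∷ r) =
  (map-trail f g t , All.map⁺ (All.map (λ p → _ , p , refl) ps)) ∷
  weaken (λ { (e′ , (p , e∉) , refl) → (e′ , p , refl) ,
            λ fe∈ → let _ , e″∈ , eq = ∈-map⁻ _ fe∈
                    in e∉ (subst (_∈ _) (sym (inj p (All.lookup ps e″∈) eq)) e″∈) })
         (map-routed f g (λ p p′ → inj (proj₁ p) (proj₁ p′)) r)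

swap-routed : {P : Edge A → Set} {D : List (Edge A)} →
  Routed P D → Routed (P ∘ swap) (map swap D)
swap-routed []             = []
swap-routed ((t , ps) ∷ r) with reverse-trail t
... | _ , t′ , h = (t′ , All.tabulate (λ e∈ → All.lookup ps (h e∈))) ∷
  weaken (λ { (p , e∉) → p , λ e∈ → e∉ (h e∈) }) (swap-routed r)

-- The trail of `(c , x)` is prolonged by a - y - c. As `P` excludes both new edges, no trail of the
-- given family can meet them.
lift : {P : Edge A → Set} {D : List (Edge A)} → ¬ P (a , y) → ¬ P (c , y) →
  Routed P ((c , x) ∷ D) →
  Routed (λ e → P e ⊎ e ≡ (a , y) ⊎ e ≡ (c , y)) ((a , x) ∷ D)
lift ¬ay ¬cy ((t , ps) ∷ r) =
  (detour t , inj₂ (inj₁ refl) ∷ inj₂ (inj₂ refl) ∷ All.map inj₁ ps) ∷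
  weaken (λ { (p , e∉) → inj₁ p ,
    λ { (here refl) → ¬ay p ; (there (here refl)) → ¬cy p ; (there (there e∈)) → e∉ e∈ } }) r

-- From trails to paths by loop erasure

module _ {n : ℕ} where

  open DecMembership (Sum.≡-dec (Fin._≟_ {n}) (Fin._≟_ {n})) using (_∈?_)

  suffix : {u v t : V n} (w : Walk u v) → Unique (verts w) → t ∈ verts w →
    Σ (Path t v) λ p → ∀ {e} → e ∈ edges (walk p) → e ∈ edges w
  suffix (stop v)   un       (here refl) = mkPath (stop v) un , id
  suffix (step s w) un       (here refl) = mkPath (step s w) un , id
  suffix (step s w) (_ ∷ un) (there t∈)  =
    let p , sub = suffix w un t∈ in p , there ∘ sub

  loop-erase : {u v : V n} (w : Walk u v) →
    Σ (Path u v) λ p → ∀ {e} → e ∈ edges (walk p) → e ∈ edges w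
  loop-erase (stop v) = mkPath (stop v) ([] ∷ []) , id
  loop-erase (step {u} s w) with loop-erase w
  ... | p , sub with u ∈? verts (walk p)
  ...   | yes u∈ = let q , sub′ = suffix (walk p) (distinct p) u∈ in q , there ∘ sub ∘ sub′
  ...   | no u∉  = mkPath (step s (walk p)) (All.¬Any⇒All¬ _ u∉ ∷ distinct p) ,
      λ { (here refl) → here refl ; (there e∈) → there (sub e∈) }

  trail-walk : {a x : Fin n} {es : List (BEdge n)} → Trail a x es →
    Σ (Walk (inj₁ a) (inj₂ x)) λ w → edges w ≡ es
  trail-walk direct = step (lr _ _) (stop _) , refl
  trail-walk (detour t) = let w , eq = trail-walk t in
    step (lr _ _) (step (rl _ _) w) , cong (λ es → _ ∷ _ ∷ es) eq

  trail-path : {a x : Fin n} {es : List (BEdge n)} → Trail a x es →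
    Σ (Path (inj₁ a) (inj₂ x)) λ p → ∀ {e} → e ∈ edges (walk p) → e ∈ es
  trail-path t = let w , eq = trail-walk t ; p , sub = loop-erase w
                 in p , λ e∈ → subst (_ ∈_) eq (sub e∈)

  PathIn : (BEdge n → Set) → BEdge n → Set
  PathIn P (a , x) = Σ (Path (inj₁ a) (inj₂ x)) λ p → ∀ {e} → e ∈ edges (walk p) → P e

  EdgesDisjoint : {u v u′ v′ : V n} → Path u v → Path u′ v′ → Set
  EdgesDisjoint p q = Disjoint (edges (walk p)) (edges (walk q))

  routed-paths : {P : BEdge n → Set} (D : Demand n) → Routed P D →
    Σ ((k : Fin (length D)) → PathIn P (lookup D k)) λ p →
      ∀ k l → k ≢ l → EdgesDisjoint (proj₁ (p k)) (proj₁ (p l))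
  routed-paths [] [] = (λ ()) , λ ()
  routed-paths ((a , x) ∷ D) ((t , ps) ∷ r) =
    let p , sub = trail-path t ; q , dis = routed-paths D r in
    (λ { zero → p , λ e∈ → All.lookup ps (sub e∈)
       ; (suc k) → proj₁ (q k) , λ e∈ → proj₁ (proj₂ (q k) e∈) }) ,
    λ { zero zero k≢l → ⊥-elim (k≢l refl)
      ; zero (suc l) _ → λ (e∈p , e∈q) → proj₂ (proj₂ (q l) e∈q) (sub e∈p)
      ; (suc k) zero _ → λ (e∈q , e∈p) → proj₂ (proj₂ (q k) e∈q) (sub e∈p)
      ; (suc k) (suc l) k≢l → dis k l (λ eq → k≢l (cong suc eq)) }

  routed-resolvable : {P : BEdge n → Set} (D : Demand n) → Routed P D → Resolvable D
  routed-resolvable D r = let p , dis = routed-paths D r in (λ k → proj₁ (p k)) , dis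

-- Exhaustive search for small orders

_≡ᵉ_ : Edge ℕ → Edge ℕ → Bool
(a , x) ≡ᵉ (b , y) = (a ≡ᵇ b) ∧ (x ≡ᵇ y)

_∈ᵇ_ : Edge ℕ → List (Edge ℕ) → Bool
e ∈ᵇ es = any (e ≡ᵉ_) es

square : ℕ → List (Edge ℕ)
square n = cartesianProduct (upTo n) (upTo n)

-- Detours of length 3 suffice, and trying large indices first keeps backtracking short: in the
-- matrices searched below the last rows and columns tend to carry the fewest demands.
candidates : ℕ → Edge ℕ → List (List (Edge ℕ))
candidates n (a , x) =
  ((a , x) ∷ []) ∷
  map (λ (c , y) → (a , y) ∷ (c , y) ∷ (c , x) ∷ [])
    (cartesianProduct (filterᵇ (λ c → not (c ≡ᵇ a)) (downFrom n))
                      (filterᵇ (λ y → not (y ≡ᵇ x)) (downFrom n)))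

solve : ℕ → List (Edge ℕ) → List (Edge ℕ) → Bool
solve n free []      = true
solve n free (d ∷ D) = any
  (λ es → all (_∈ᵇ free) es ∧ solve n (filterᵇ (λ e → not (e ∈ᵇ es)) free) D)
  (candidates n d)

compositions : ℕ → ℕ → List (List ℕ)
compositions zero    zero    = [] ∷ []
compositions zero    (suc s) = []
compositions (suc k) s       =
  concatMap (λ i → map (i ∷_) (compositions k (s ∸ i))) (upTo (suc s))

matrices : ℕ → List ℕ → List (List (List ℕ))
matrices k []       = [] ∷ []
matrices k (r ∷ rs) = concatMap (λ l → map (l ∷_) (matrices k rs)) (compositions k r)

descending : List ℕ → Bool
descending (m ∷ l@(n ∷ _)) = (n ≤ᵇ m) ∧ descending l
descending _               = true

head-descending : List (List ℕ) → Bool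
head-descending []      = true
head-descending (l ∷ _) = descending l

-- The fold ends in four zeros, so on rows of length 4 each entry unfolds to the `sum` of a column;
-- `columns≡` relies on this.
column-sums : List (List ℕ) → List ℕ
column-sums = foldr (zipWith _+_) (0 ∷ 0 ∷ 0 ∷ 0 ∷ [])

nth : {A : Set} → A → List A → ℕ → A
nth d []       _       = d
nth d (x ∷ xs) zero    = x
nth d (x ∷ xs) (suc i) = nth d xs i

-- The index types are arbitrary because the same construction is used for positions and for
-- vertices; `map-layout` compares the two.
layout : {A B : Set} → (A → B → ℕ) → List A → List B → List (A × B)
layout m as xs = concatMap (λ a → concatMap (λ x → replicate (m a x) (a , x)) xs) as

demands : List (List ℕ) → List (Edge ℕ)
demands M = layout (λ i → nth 0 (nth [] M i)) (upTo 4) (upTo 4)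

-- Symmetry is broken twice: rows can be permuted until their sums descend, and then columns until
-- the first row descends, which leaves the row sums alone. The matrices are always 4 by 4, while
-- `n` is the order of the graph in which detours may run.
check : (ℕ → Bool) → ℕ → ℕ → Bool
check ok n total = all
  (λ rs → not (descending rs ∧ all ok rs) ∨ all
    (λ M → not (head-descending M ∧ all ok (column-sums M)) ∨
           solve n (square n) (demands M))
    (matrices 4 rs))
  (compositions 4 total)

T-imp : ∀ b {c} → T (not b ∨ c) → T b → T c
T-imp true t _ = t

T-all : ∀ {A : Set} (p : A → Bool) {xs} → T (all p xs) → ∀ {x} → x ∈ xs → T (p x)
T-all p t = All.lookup (All.all⁺ p _ t)

candidates-trails : ∀ n a x → All (Trail a x) (candidates n (a , x))
candidates-trails n a x = direct ∷ All.map⁺ (All.universal (λ _ → detour direct) _)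

≡ᵉ-sound : ∀ e e′ → T (e ≡ᵉ e′) → e ≡ e′
≡ᵉ-sound (a , x) (b , y) t = let p , q = to T-∧ t in
  cong₂ _,_ (≡ᵇ⇒≡ a b p) (≡ᵇ⇒≡ x y q)

≡ᵉ-refl : ∀ e → T (e ≡ᵉ e)
≡ᵉ-refl (a , x) = from T-∧ (≡⇒≡ᵇ a a refl , ≡⇒≡ᵇ x x refl)

∈ᵇ-sound : ∀ e es → T (e ∈ᵇ es) → e ∈ es
∈ᵇ-sound e es t = Any.map (≡ᵉ-sound e _) (Any.any⁻ _ es t)

∈ᵇ-complete : ∀ {e es} → e ∈ es → T (e ∈ᵇ es)
∈ᵇ-complete {e} e∈ = Any.any⁺ _ (Any.map (λ { refl → ≡ᵉ-refl e }) e∈)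

T-not : ∀ {b} → T (not b) → T b → {A : Set} → A
T-not {true}  () _
T-not {false} _ ()

solve-sound : ∀ n free D → T (solve n free D) → Routed (_∈ free) D
solve-sound n free []            t = []
solve-sound n free ((a , x) ∷ D) t
  with es , es∈ , s ← find (Any.any⁻ _ (candidates n (a , x)) t) =
  let inFree , rest = to T-∧ s in
  (All.lookup (candidates-trails n a x) es∈ ,
   All.map (∈ᵇ-sound _ free) (All.all⁺ _ es inFree)) ∷
  weaken (λ e∈ → let e∈free , e∉ = ∈-filter⁻ (λ e → T? (not (e ∈ᵇ es))) {xs = free} e∈ in
                 e∈free , λ e∈es → T-not e∉ (∈ᵇ-complete e∈es))
    (solve-sound n _ D rest)

compositions-complete : ∀ l → l ∈ compositions (length l) (sum l)
compositions-complete []      = here refl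
compositions-complete (i ∷ l) = ∈-concatMap⁺ _ (lose (∈-upTo⁺ (s≤s (m≤m+n i (sum l))))
  (∈-map⁺ (i ∷_) (subst (λ s → l ∈ compositions (length l) s)
                        (sym (m+n∸m≡n i (sum l))) (compositions-complete l))))

matrices-complete : ∀ {k} M → All (λ l → length l ≡ k) M → M ∈ matrices k (map sum M)
matrices-complete []      []           = here refl
matrices-complete (l ∷ M) (refl ∷ lens) = ∈-concatMap⁺ _
  (lose (compositions-complete l) (∈-map⁺ (l ∷_) (matrices-complete M lens)))

check-sound : ∀ ok n M → length M ≡ 4 → All (λ l → length l ≡ 4) M →
  T (check ok n (sum (map sum M))) →
  T (descending (map sum M)) → T (all ok (map sum M)) →
  T (head-descending M) → T (all ok (column-sums M)) →
  Routed (_∈ square n) (demands M)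
check-sound ok n M len lens checked desc okRows headDesc okCols =
  solve-sound n (square n) (demands M)
    (T-imp _ (T-all _ (T-imp _ (T-all _ checked rs∈) (from T-∧ (desc , okRows)))
                      (matrices-complete M lens))
             (from T-∧ (headDesc , okCols)))
  where
  rs∈ : map sum M ∈ compositions 4 (sum (map sum M))
  rs∈ = subst (λ k → map sum M ∈ compositions k (sum (map sum M))) (trans (length-map sum M) len)
          (compositions-complete (map sum M))

descending⁺ : ∀ {A : Set} (key : A → ℕ) {xs} →
  Linked (λ x y → key y ≤ key x) xs → T (descending (map key xs))
descending⁺ key []       = _
descending⁺ key [-]      = _
descending⁺ key (p ∷ ps) = from T-∧ (≤⇒≤ᵇ p , descending⁺ key ps)

-- At order 5 the degree 1 is excluded, since a vertex of degree 1 allows a reduction to order 4.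
ok₄ ok₅ : ℕ → Bool
ok₄ d = d ≤ᵇ 4
ok₅ d = (d ≤ᵇ 5) ∧ not (d ≡ᵇ 1)

-- The totals 6 and 8 are 2n - 2 for the orders 4 and 5; both searches are run by the type checker.
check₄ : check ok₄ 4 6 ≡ true
check₄ = refl
check₅ : check ok₅ 5 8 ≡ true
check₅ = refl

-- Counting

extract : {P : X → Set} → Decidable P → ∀ xs →
  (∃₂ λ x xs′ → P x × xs ↭ x ∷ xs′) ⊎ All (λ x → ¬ P x) xs
extract P? []       = inj₂ []
extract P? (x ∷ xs) with P? x | extract P? xs
... | yes p | _                         = inj₁ (x , xs , p , ↭-refl)
... | no ¬p | inj₂ ¬ps                  = inj₂ (¬p ∷ ¬ps)
... | no ¬p | inj₁ (y , ys , p , perm)  =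
  inj₁ (y , x ∷ ys , p , ↭-trans (↭-prep x perm) (↭.swap x y ↭-refl))

count : (X → Fin N) → Fin N → List X → ℕ
count key v D = length (filter (λ d → key d ≟ v) D)

module _ (key : X → Fin N) {v : Fin N} where

  count-≡ : ∀ {d D} → key d ≡ v → count key v (d ∷ D) ≡ suc (count key v D)
  count-≡ eq = cong length (filter-accept (λ d → key d ≟ v) eq)

  count-≢ : ∀ {d D} → key d ≢ v → count key v (d ∷ D) ≡ count key v D
  count-≢ neq = cong length (filter-reject (λ d → key d ≟ v) neq)

  count-↭ : ∀ {D D′} → D ↭ D′ → count key v D ≡ count key v D′
  count-↭ perm = ↭-length (filter-↭ (λ d → key d ≟ v) perm)

  count-++ : ∀ D {D′} → count key v (D ++ D′) ≡ count key v D + count key v D′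
  count-++ D {D′} = trans (cong length (filter-++ (λ d → key d ≟ v) D D′)) (length-++ (filter _ D))

  count-absent : ∀ {D} → All (λ d → key d ≢ v) D → count key v D ≡ 0
  count-absent []         = refl
  count-absent (neq ∷ ps) = trans (count-≢ neq) (count-absent ps)

  count-all : ∀ {D} → All (λ d → key d ≡ v) D → count key v D ≡ length D
  count-all ps = cong length (filter-all (λ d → key d ≟ v) ps)

  count-≤-∷ : ∀ {d D} → count key v D ≤ count key v (d ∷ D)
  count-≤-∷ {d} with key d ≟ v
  ... | yes _ = n≤1+n _
  ... | no  _ = ≤-refl

  count-pos : ∀ {D} → 1 ≤ count key v D → ∃₂ λ d D′ → key d ≡ v × D ↭ d ∷ D′
  count-pos {D} pos with extract (λ d → key d ≟ v) D
  ... | inj₁ found = found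
  ... | inj₂ none  = ⊥-elim (1+n≰n (≤-trans pos (≤-reflexive (count-absent none))))

-- A multiplicity can be read off row first or column first; hence the column sums of the
-- multiplicity matrix are column degrees.
count-comm : (k : X → Fin N) (l : X → Fin N) (v w : Fin N) (D : List X) →
  count k v (filter (λ d → l d ≟ w) D) ≡ count l w (filter (λ d → k d ≟ v) D)
count-comm k l v w []      = refl
count-comm k l v w (d ∷ D) with l d ≟ w in eq | k d ≟ v in eq′
... | yes p | yes q = trans (count-≡ k q) (trans (cong suc (count-comm k l v w D)) (sym (count-≡ l p)))
... | yes p | no q = trans (count-≢ k q) (count-comm k l v w D)
... | no p  | yes q = trans (count-comm k l v w D) (sym (count-≢ l p))
... | no p  | no q = count-comm k l v w D

module _ (key : X → Fin N) where

  fibre : List X → Fin N → List X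
  fibre D v = filter (λ d → key d ≟ v) D

  group-∷-∉ : ∀ {d D} Vs → key d ∉ Vs → concatMap (fibre (d ∷ D)) Vs ≡ concatMap (fibre D) Vs
  group-∷-∉ []       _ = refl
  group-∷-∉ (v ∷ Vs) d∉ =
    cong₂ _++_ (filter-reject (λ d → key d ≟ v) (d∉ ∘ here)) (group-∷-∉ Vs (d∉ ∘ there))

  group-∷-∈ : ∀ {d D Vs} → Unique Vs → key d ∈ Vs →
    concatMap (fibre (d ∷ D)) Vs ↭ d ∷ concatMap (fibre D) Vs
  group-∷-∈ {d} {D} {v ∷ Vs} (v∉ ∷ _) (here refl) = ↭-reflexive
    (cong₂ _++_ (filter-accept (λ d → key d ≟ v) refl)
                (group-∷-∉ {d} {D} Vs (All.All¬⇒¬Any v∉)))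
  group-∷-∈ {d} {D} {v ∷ Vs} (v∉ ∷ un) (there d∈) = begin
    concatMap (fibre (d ∷ D)) (v ∷ Vs)
      ≡⟨ cong (_++ concatMap (fibre (d ∷ D)) Vs)
           (filter-reject (λ d → key d ≟ v) (λ eq → All.lookup v∉ d∈ (sym eq))) ⟩
    fibre D v ++ concatMap (fibre (d ∷ D)) Vs
      ↭⟨ ++⁺ˡ (fibre D v) (group-∷-∈ un d∈) ⟩
    fibre D v ++ d ∷ concatMap (fibre D) Vs
      ↭⟨ shift d (fibre D v) _ ⟩
    d ∷ concatMap (fibre D) (v ∷ Vs) ∎
    where open PermutationReasoning

  group-[] : ∀ Vs → concatMap (fibre []) Vs ≡ []
  group-[] []       = refl
  group-[] (_ ∷ Vs) = group-[] Vs

  group : ∀ {Vs D} → Unique Vs → All (λ d → key d ∈ Vs) D → concatMap (fibre D) Vs ↭ D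
  group {Vs} un []       = ↭-reflexive (group-[] Vs)
  group      un (p ∷ ps) = ↭-trans (group-∷-∈ un p) (↭-prep _ (group un ps))

  sum-count : ∀ {Vs D} → Unique Vs → All (λ d → key d ∈ Vs) D →
    sum (map (λ v → count key v D) Vs) ≡ length D
  sum-count {Vs} {D} un ps = trans (sum-lengths Vs) (↭-length (group un ps))
    where
    sum-lengths : ∀ Vs → sum (map (λ v → count key v D) Vs) ≡ length (concatMap (fibre D) Vs)
    sum-lengths []       = refl
    sum-lengths (v ∷ Vs) =
      trans (cong (count key v D +_) (sum-lengths Vs)) (sym (length-++ (fibre D v)))

concatMap-↭ : {f g : X → List Y} (xs : List X) → (∀ {x} → x ∈ xs → f x ↭ g x) →
  concatMap f xs ↭ concatMap g xs
concatMap-↭ []       h = ↭-refl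
concatMap-↭ (x ∷ xs) h = ++⁺ (h (here refl)) (concatMap-↭ xs (h ∘ there))

all-replicate : ∀ {x : X} {xs} → All (_≡ x) xs → xs ≡ replicate (length xs) x
all-replicate []          = refl
all-replicate (refl ∷ ps) = cong (_ ∷_) (all-replicate ps)

-- Multiplicity matrices and the transfer of the search to arbitrary vertices

Demands : ℕ → Set
Demands N = List (Edge (Fin N))

rdeg cdeg : Demands N → Fin N → ℕ
rdeg D a = count proj₁ a D
cdeg D x = count proj₂ x D

Box : List (Fin N) → List (Fin N) → Edge (Fin N) → Set
Box As Bs (a , x) = a ∈ As × x ∈ Bs

multiplicity : Demands N → Fin N → Fin N → ℕ
multiplicity D a x = count proj₂ x (fibre proj₁ D a)

-- The demands are grouped by row and, inside a row, by column; the demands of one cell are all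
-- equal, so the cell is a `replicate`.
layout-↭ : ∀ {As Bs} {D : Demands N} → Unique As → Unique Bs → All (Box As Bs) D →
  layout (multiplicity D) As Bs ↭ D
layout-↭ {As = As} {Bs} {D} unA unB box = ↭-trans (concatMap-↭ As row) (group proj₁ unA (All.map proj₁ box))
  where
  cell : ∀ {a x} → fibre proj₂ (fibre proj₁ D a) x ≡ replicate (multiplicity D a x) (a , x)
  cell {a} {x} = all-replicate (All.tabulate λ e∈ →
    let e∈₁ , eq₂ = ∈-filter⁻ (λ e → proj₂ e ≟ x) {xs = fibre proj₁ D a} e∈
        _   , eq₁ = ∈-filter⁻ (λ e → proj₁ e ≟ a) {xs = D} e∈₁
    in cong₂ _,_ eq₁ eq₂)
  row : ∀ {a} → a ∈ As → concatMap (λ x → replicate (multiplicity D a x) (a , x)) Bs ↭ fibre proj₁ D a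
  row {a} _ = ↭-trans (concatMap-↭ Bs (λ _ → ↭-reflexive (sym cell)))
    (group proj₂ unB (All.map proj₂ (All.filter⁺ (λ e → proj₁ e ≟ a) box)))

map-layout : {A B A′ B′ : Set} (m : A′ → B′ → ℕ) (f : A → A′) (g : B → B′) (is : List A) (js : List B) →
  map (λ e → f (proj₁ e) , g (proj₂ e)) (layout (λ i j → m (f i) (g j)) is js) ≡
  layout m (map f is) (map g js)
map-layout m f g []       js = refl
map-layout {A} {B} m f g (i ∷ is) js =
  trans (map-++ fg (cells js) _) (cong₂ _++_ (row js) (map-layout m f g is js))
  where
  fg : A × B → _
  fg e = f (proj₁ e) , g (proj₂ e)
  cells : List B → List (A × B)
  cells = concatMap (λ j → replicate (m (f i) (g j)) (i , j))
  row : ∀ js → map fg (cells js) ≡ concatMap (λ y → replicate (m (f i) y) (f i , y)) (map g js)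
  row []       = refl
  row (j ∷ js) = trans (map-++ fg (replicate (m (f i) (g j)) (i , j)) (cells js))
    (cong₂ _++_ (map-replicate fg (m (f i) (g j)) (i , j)) (row js))

nth-∈ : ∀ {d : X} xs {i} → i < length xs → nth d xs i ∈ xs
nth-∈ (x ∷ xs) {zero}  _         = here refl
nth-∈ (x ∷ xs) {suc i} (s≤s i<n) = there (nth-∈ xs i<n)

nth-injective : ∀ {d : X} {xs i j} → Unique xs → i < length xs → j < length xs →
  nth d xs i ≡ nth d xs j → i ≡ j
nth-injective {i = zero}  {zero}  _         _       _       _  = refl
nth-injective {i = zero}  {suc j} (x∉ ∷ _)  _       (s≤s p) eq = ⊥-elim (All.lookup x∉ (nth-∈ _ p) eq)
nth-injective {i = suc i} {zero}  (x∉ ∷ _)  (s≤s p) _       eq = ⊥-elim (All.lookup x∉ (nth-∈ _ p) (sym eq))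
nth-injective {i = suc i} {suc j} (_ ∷ un)  (s≤s p) (s≤s q) eq = cong suc (nth-injective un p q eq)

-- Vertices are named by their positions in `A₄ ++ As′` and `B₄ ++ Bs′`. All demands lie on the
-- first four positions; the others serve detours only.
base-sorted : ∀ ok n total → T (check ok n total) →
  ∀ {a₀ a₁ a₂ a₃ x₀ x₁ x₂ x₃ : Fin N} {As′ Bs′ D} →
  let A₄ = a₀ ∷ a₁ ∷ a₂ ∷ a₃ ∷ []
      B₄ = x₀ ∷ x₁ ∷ x₂ ∷ x₃ ∷ [] in
  Unique (A₄ ++ As′) → length (A₄ ++ As′) ≡ n →
  Unique (B₄ ++ Bs′) → length (B₄ ++ Bs′) ≡ n →
  All (Box A₄ B₄) D → length D ≡ total →
  All (λ a → T (ok (rdeg D a))) A₄ → All (λ x → T (ok (cdeg D x))) B₄ →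
  T (descending (map (rdeg D) A₄)) → T (descending (map (multiplicity D a₀) B₄)) →
  Routed (Box (A₄ ++ As′) (B₄ ++ Bs′)) D
base-sorted {N} ok n total checked {a₀} {a₁} {a₂} {a₃} {x₀} {x₁} {x₂} {x₃} {As′} {Bs′} {D}
  unA lenA unB lenB box lenD okA okB descA desc₀ =
  permute perm (weaken inBox (map-routed f g injective
    (check-sound ok n M refl (refl ∷ refl ∷ refl ∷ refl ∷ [])
       (subst (T ∘ check ok n) (sym total≡) checked)
       (subst (T ∘ descending) (sym rows≡) descA)
       (subst (T ∘ all ok) (sym rows≡) (All.all⁻ ok (All.map⁺ okA)))
       desc₀
       (subst (T ∘ all ok) (sym columns≡) (All.all⁻ ok (All.map⁺ okB))))))
  where
  A₄ B₄ : List (Fin N)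
  A₄ = a₀ ∷ a₁ ∷ a₂ ∷ a₃ ∷ []
  B₄ = x₀ ∷ x₁ ∷ x₂ ∷ x₃ ∷ []
  f g : ℕ → Fin N
  -- The default is never returned on `square n`, because both lists have length `n`.
  f = nth a₀ (A₄ ++ As′)
  g = nth x₀ (B₄ ++ Bs′)
  m : Fin N → Fin N → ℕ
  m = multiplicity D
  M : List (List ℕ)
  M = map (λ a → map (m a) B₄) A₄
  un₄ : ∀ {y₀ y₁ y₂ y₃ : Fin N} {ys} → Unique (y₀ ∷ y₁ ∷ y₂ ∷ y₃ ∷ ys) → Unique (y₀ ∷ y₁ ∷ y₂ ∷ y₃ ∷ [])
  un₄ ((p₁ ∷ p₂ ∷ p₃ ∷ _) ∷ (p₄ ∷ p₅ ∷ _) ∷ (p₆ ∷ _) ∷ _) =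
    (p₁ ∷ p₂ ∷ p₃ ∷ []) ∷ (p₄ ∷ p₅ ∷ []) ∷ (p₆ ∷ []) ∷ [] ∷ []
  row-sum : ∀ a → sum (map (m a) B₄) ≡ rdeg D a
  row-sum a = sum-count proj₂ (un₄ unB) (All.map proj₂ (All.filter⁺ (λ e → proj₁ e ≟ a) box))
  rows≡ : map sum M ≡ map (rdeg D) A₄
  rows≡ = map-cong row-sum A₄
  column-sum : ∀ x → sum (map (λ a → m a x) A₄) ≡ cdeg D x
  column-sum x = trans (cong sum (map-cong (λ a → count-comm proj₂ proj₁ x a D) A₄))
    (sum-count proj₁ (un₄ unA) (All.map proj₁ (All.filter⁺ (λ e → proj₂ e ≟ x) box)))
  columns≡ : column-sums M ≡ map (cdeg D) B₄
  columns≡ = map-cong column-sum B₄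
  total≡ : sum (map sum M) ≡ total
  total≡ = trans (cong sum rows≡) (trans (sum-count proj₁ (un₄ unA) (All.map proj₁ box)) lenD)
  perm : map (λ e → f (proj₁ e) , g (proj₂ e)) (demands M) ↭ D
  perm = ↭-trans (↭-reflexive (map-layout m f g (upTo 4) (upTo 4))) (layout-↭ (un₄ unA) (un₄ unB) box)
  bounds : ∀ {e} → e ∈ square n → proj₁ e < n × proj₂ e < n
  bounds e∈ = let p , q = ∈-cartesianProduct⁻ (upTo n) (upTo n) e∈ in ∈-upTo⁻ p , ∈-upTo⁻ q
  row< : ∀ {e} → e ∈ square n → proj₁ e < length (A₄ ++ As′)
  row< e∈ = subst (_ <_) (sym lenA) (proj₁ (bounds e∈))
  col< : ∀ {e} → e ∈ square n → proj₂ e < length (B₄ ++ Bs′)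
  col< e∈ = subst (_ <_) (sym lenB) (proj₂ (bounds e∈))
  inBox : ∀ {e} → (∃ λ e′ → e′ ∈ square n × e ≡ (f (proj₁ e′) , g (proj₂ e′))) →
    Box (A₄ ++ As′) (B₄ ++ Bs′) e
  inBox (e′ , e∈ , refl) = nth-∈ (A₄ ++ As′) (row< e∈) , nth-∈ (B₄ ++ Bs′) (col< e∈)
  injective : ∀ {e e′} → e ∈ square n → e′ ∈ square n →
    (f (proj₁ e) , g (proj₂ e)) ≡ (f (proj₁ e′) , g (proj₂ e′)) → e ≡ e′
  injective e∈ e′∈ eq = cong₂ _,_
    (nth-injective unA (row< e∈) (row< e′∈) (cong proj₁ eq))
    (nth-injective unB (col< e∈) (col< e′∈) (cong proj₂ eq))

sort-descending : (key : X → ℕ) (xs : List X) →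
  ∃ λ ys → ys ↭ xs × T (descending (map key ys))
sort-descending key xs = sort O xs , sort-↭ O xs , descending⁺ key (sort-↗ O xs)
  where O = On.decTotalOrder (Flip.decTotalOrder ≤-decTotalOrder) key

sort-descending₄ : (key : X → ℕ) (xs : List X) → length xs ≡ 4 →
  ∃₂ λ y₀ y₁ → ∃₂ λ y₂ y₃ →
    let ys = y₀ ∷ y₁ ∷ y₂ ∷ y₃ ∷ [] in ys ↭ xs × T (descending (map key ys))
sort-descending₄ key xs len with sort-descending key xs
... | y₀ ∷ y₁ ∷ y₂ ∷ y₃ ∷ [] , perm , desc = y₀ , y₁ , y₂ , y₃ , perm , desc
... | [] , perm , _ = ⊥-elim (case trans (↭-length perm) len of λ ())
... | _ ∷ [] , perm , _ = ⊥-elim (case trans (↭-length perm) len of λ ())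
... | _ ∷ _ ∷ [] , perm , _ = ⊥-elim (case trans (↭-length perm) len of λ ())
... | _ ∷ _ ∷ _ ∷ [] , perm , _ = ⊥-elim (case trans (↭-length perm) len of λ ())
... | _ ∷ _ ∷ _ ∷ _ ∷ _ ∷ _ , perm , _ = ⊥-elim (case trans (↭-length perm) len of λ ())

unique-↭ : {xs ys : List X} → xs ↭ ys → Unique xs → Unique ys
unique-↭ perm = ↭ₛ.Unique-resp-↭ (setoid _) (↭⇒↭ₛ perm)

box-↭ : {As As′ Bs Bs′ : List (Fin N)} → As ↭ As′ → Bs ↭ Bs′ → ∀ {e} → Box As Bs e → Box As′ Bs′ e
box-↭ p q (a∈ , x∈) = ∈-resp-↭ p a∈ , ∈-resp-↭ q x∈

base : ∀ ok n total → check ok n total ≡ true → ∀ {A₄ B₄ As′ Bs′ : List (Fin N)} {D} →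
  length A₄ ≡ 4 → length B₄ ≡ 4 →
  Unique (A₄ ++ As′) → length (A₄ ++ As′) ≡ n →
  Unique (B₄ ++ Bs′) → length (B₄ ++ Bs′) ≡ n →
  All (Box A₄ B₄) D → length D ≡ total →
  All (λ a → T (ok (rdeg D a))) A₄ → All (λ x → T (ok (cdeg D x))) B₄ →
  Routed (Box (A₄ ++ As′) (B₄ ++ Bs′)) D
base ok n total checked {A₄} {B₄} {As′} {Bs′} {D} len₄ len₄′ unA lenA unB lenB box lenD okA okB
  -- Rows come first: the columns are sorted by their entries in `a₀`, the row that ends up on top.
  with a₀ , a₁ , a₂ , a₃ , permA , descA ← sort-descending₄ (rdeg D) A₄ len₄
  with x₀ , x₁ , x₂ , x₃ , permB , desc₀ ← sort-descending₄ (multiplicity D a₀) B₄ len₄′ =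
  weaken (box-↭ (++⁺ʳ As′ permA) (++⁺ʳ Bs′ permB))
    (base-sorted ok n total (from T-≡ checked)
      (unique-↭ (++⁺ʳ As′ (↭-sym permA)) unA) (trans (↭-length (++⁺ʳ As′ permA)) lenA)
      (unique-↭ (++⁺ʳ Bs′ (↭-sym permB)) unB) (trans (↭-length (++⁺ʳ Bs′ permB)) lenB)
      (All.map (box-↭ (↭-sym permA) (↭-sym permB)) box) lenD
      (All-resp-↭ (↭-sym permA) okA) (All-resp-↭ (↭-sym permB) okB) descA desc₀)

-- Lowering degrees through deleted vertices

_∈?_ : (e : Edge (Fin N)) (K : List (Edge (Fin N))) → Dec (e ∈ K)
_∈?_ = mem? (Product.≡-dec _≟_ _≟_)

count-two : (key : X → Fin N) {u v : Fin N} → u ≢ v → ∀ D → count key u D + count key v D ≤ length D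
count-two key u≢v []      = z≤n
count-two key {u} {v} u≢v (d ∷ D) with key d ≟ u | key d ≟ v
... | yes p | yes q = ⊥-elim (u≢v (trans (sym p) q))
... | yes p | no _  = s≤s (count-two key u≢v D)
... | no _  | yes _ = ≤-trans (≤-reflexive (+-suc _ _)) (s≤s (count-two key u≢v D))
... | no _  | no _  = m≤n⇒m≤1+n (count-two key u≢v D)

count-∷-≤ : (key : X → Fin N) (v : Fin N) (d : X) (D : List X) → count key v (d ∷ D) ≤ suc (count key v D)
count-∷-≤ key v d D with key d ≟ v
... | yes _ = ≤-refl
... | no  _ = n≤1+n _

count-∷-cong : (key : X → Fin N) (v : Fin N) (d d′ : X) (D : List X) → key d ≡ key d′ →
  count key v (d ∷ D) ≡ count key v (d′ ∷ D)
count-∷-cong key v d d′ D eq with key d ≟ v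
... | yes p = sym (count-≡ key (trans (sym eq) p))
... | no ¬p = sym (count-≢ key (¬p ∘ trans eq))

count-map : (key : Y → Fin N) (f : X → Y) (v : Fin N) (D : List X) → count key v (map f D) ≡ count (key ∘ f) v D
count-map key f v [] = refl
count-map key f v (d ∷ D) with key (f d) ≟ v
... | yes _ = cong suc (count-map key f v D)
... | no _  = count-map key f v D

count-∈ : (key : X → Fin N) {d : X} {D : List X} → d ∈ D → 1 ≤ count key (key d) D
count-∈ key {D = d ∷ D} (here refl) = ≤-trans (s≤s z≤n) (≤-reflexive (sym (count-≡ key {D = D} refl)))
count-∈ key {D = d ∷ D} (there d∈)  = ≤-trans (count-∈ key d∈) (count-≤-∷ key)

count-zero : (key : X → Fin N) {v : Fin N} {D : List X} → count key v D ≡ 0 → All (λ d → key d ≢ v) D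
count-zero key eq = All.tabulate λ { d∈ refl → 1+n≰n (≤-trans (count-∈ key d∈) (≤-reflexive eq)) }

-- With `K` the occupied edges, this bounds how many demands `v` can still hand over through the
-- deleted vertices `bs`, one through each.
free : List (Edge (Fin N)) → List (Fin N) → Fin N → ℕ
free K bs v = length (filter (λ b → ¬? ((v , b) ∈? K)) bs)

Link : List (Fin N) → List (Fin N) → List (Edge (Fin N)) → Edge (Fin N) → Set
Link As bs K e = proj₁ e ∈ As × proj₂ e ∈ bs × e ∉ K

-- `routed` pulls a routing of `D′` that avoids `bs` back to `D`. The equality `cols` allows the
-- other class to be lowered afterwards against its original bounds.
record Lowering (As Bs bs : List (Fin N)) (K : List (Edge (Fin N))) (k : ℕ) (D : Demands N) : Set₁ where
  field
    D′     : Demands N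
    box    : All (Box As Bs) D′
    len    : length D′ ≡ length D
    rows   : ∀ {v} → v ∈ As → rdeg D′ v ≤ k
    cols   : ∀ x → cdeg D′ x ≡ cdeg D x
    routed : {P : Edge (Fin N) → Set} → (∀ {b v} → b ∈ bs → ¬ P (v , b)) →
             Routed P D′ → Routed (λ e → P e ⊎ Link As bs K e) D

-- As length D ≤ 2k, at most one row exceeds k, and the other rows stay below k when
-- a demand is moved onto them.
lower : ∀ {As Bs bs : List (Fin N)} {K k D} → Unique bs → All (Box As Bs) D → length D ≤ k + k →
  (∀ {v} → v ∈ As → rdeg D v ≤ k + free K bs v) →
  (∀ {b} → b ∈ bs → ∀ v → ∃ λ c → c ∈ As × c ≢ v × (c , b) ∉ K) →
  Lowering As Bs bs K k D
lower {bs = []} _ box _ bound _ = record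
  { D′ = _ ; box = box ; len = refl ; rows = λ v∈ → ≤-trans (bound v∈) (≤-reflexive (+-identityʳ _))
  ; cols = λ _ → refl ; routed = λ _ → weaken inj₁ }
lower {As = As} {Bs} {b ∷ bs} {K} {k} {D} (b∉ ∷ un) box len≤ bound spare
  with extract (λ v → (k <? rdeg D v) ×-dec ¬? ((v , b) ∈? K)) As
-- The vertex `b` is passed over: a row above `k` can only have its edge to `b` in `K`, so `b` was
-- not counted in its `free`.
... | inj₂ none = record
  { D′ = L.D′ ; box = L.box ; len = L.len ; rows = L.rows ; cols = L.cols
  ; routed = λ avoid r → weaken (λ { (inj₁ p) → inj₁ p ; (inj₂ (v∈ , b∈ , e∉)) → inj₂ (v∈ , there b∈ , e∉) })
                           (L.routed (avoid ∘ there) r) }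
  where
  bound′ : ∀ {v} → v ∈ As → rdeg D v ≤ k + free K bs v
  bound′ {v} v∈ with k <? rdeg D v | (v , b) ∈? K
  ... | no ¬heavy | _      = ≤-trans (≮⇒≥ ¬heavy) (m≤m+n k _)
  ... | yes heavy | no  e∉ = ⊥-elim (All.lookup none v∈ (heavy , e∉))
  ... | yes heavy | yes e∈ = ≤-trans (bound v∈) (≤-reflexive
        (cong (λ l → k + length l) (filter-reject (λ b → ¬? ((v , b) ∈? K)) (λ e∉ → e∉ e∈))))
  module L = Lowering (lower {bs = bs} {K} un box len≤ bound′ (spare ∘ there))
... | inj₁ (v , _ , (heavy , vb∉) , permA)
  with (_ , x) , D₁ , refl , permD ← count-pos proj₁ {v} {D} (≤-trans (s≤s z≤n) heavy)
  with c , c∈ , c≢v , cb∉ ← spare (here refl) v = record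
  { D′ = L.D′ ; box = L.box ; len = trans L.len (sym (↭-length permD)) ; rows = L.rows
  ; cols = λ y → trans (L.cols y) (trans (count-∷-cong proj₂ y (c , x) (v , x) D₁ refl) (sym (count-↭ proj₂ permD)))
  ; routed = λ {P} avoid r → permute (↭-sym permD) (weaken
      (λ { (inj₁ (inj₁ p)) → inj₁ p
         ; (inj₁ (inj₂ (u∈ , b∈ , e∉))) → inj₂ (u∈ , there b∈ , e∉)
         ; (inj₂ (inj₁ refl)) → inj₂ (v∈ , here refl , vb∉)
         ; (inj₂ (inj₂ refl)) → inj₂ (c∈ , here refl , cb∉) })
      (lift (unlinked {P} avoid v) (unlinked {P} avoid c) (L.routed (avoid ∘ there) r))) }
  where
  v∈ : v ∈ As
  v∈ = ∈-resp-↭ (↭-sym permA) (here refl)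
  unlinked : {P : Edge (Fin _) → Set} → (∀ {b′ u} → b′ ∈ b ∷ bs → ¬ P (u , b′)) →
    ∀ u → ¬ (P (u , b) ⊎ Link As bs K (u , b))
  unlinked avoid _ (inj₁ p)            = avoid (here refl) p
  unlinked avoid _ (inj₂ (_ , b∈ , _)) = All.lookup b∉ b∈ refl
  box₁ : All (Box As Bs) ((v , x) ∷ D₁)
  box₁ = All-resp-↭ permD box
  bound′ : ∀ {u} → u ∈ As → rdeg ((c , x) ∷ D₁) u ≤ k + free K bs u
  bound′ {u} u∈ with u ≟ v
  ... | yes refl = ≤-trans (≤-reflexive (count-≢ proj₁ c≢v)) (+-cancelˡ-≤ 1 _ _ (begin
    suc (rdeg D₁ u)          ≡⟨ count-≡ proj₁ {d = u , x} {D₁} refl ⟨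
    rdeg ((u , x) ∷ D₁) u    ≡⟨ count-↭ proj₁ permD ⟨
    rdeg D u                 ≤⟨ bound u∈ ⟩
    k + free K (b ∷ bs) u    ≡⟨ cong (λ l → k + length l) (filter-accept (λ b → ¬? ((u , b) ∈? K)) vb∉) ⟩
    k + suc (free K bs u)    ≡⟨ +-suc k _ ⟩
    suc (k + free K bs u)    ∎))
    where open ≤-Reasoning
  ... | no u≢v = ≤-trans (+-cancelʳ-≤ k _ _ (begin
    rdeg ((c , x) ∷ D₁) u + k  ≤⟨ +-monoˡ-≤ k (count-∷-≤ proj₁ u (c , x) D₁) ⟩
    suc (rdeg D₁ u + k)        ≡⟨ +-suc _ k ⟨
    rdeg D₁ u + suc k          ≡⟨ cong (_+ suc k) (sym (trans (count-↭ proj₁ permD) (count-≢ proj₁ (u≢v ∘ sym)))) ⟩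
    rdeg D u + suc k           ≤⟨ +-monoʳ-≤ (rdeg D u) heavy ⟩
    rdeg D u + rdeg D v        ≤⟨ count-two proj₁ u≢v D ⟩
    length D                   ≤⟨ len≤ ⟩
    k + k                      ∎)) (m≤m+n k _)
    where open ≤-Reasoning
  module L = Lowering (lower {bs = bs} {K} un ((c∈ , proj₂ (All.head box₁)) ∷ All.tail box₁)
    (≤-trans (≤-reflexive (sym (↭-length permD))) len≤) bound′ (spare ∘ there))

-- Instances with exactly 2n - 2 demands and their symmetries

swap-box : ∀ {As Bs : List (Fin N)} {D} → All (Box As Bs) D → All (Box Bs As) (map swap D)
swap-box = All.map⁺ ∘ All.map swap

swap-swap : (D : Demands N) → map swap (map swap D) ≡ D
swap-swap []      = refl
swap-swap (_ ∷ D) = cong (_ ∷_) (swap-swap D)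

-- The classes are lists inside a fixed `Fin N`, so that deleting vertices leaves the type of the
-- demands unchanged. `total` avoids the truncated subtraction in 2n - 2.
record Instance (n : ℕ) (As Bs : List (Fin N)) (D : Demands N) : Set where
  field
    unA : Unique As
    unB : Unique Bs
    lenA : length As ≡ n
    lenB : length Bs ≡ n
    box : All (Box As Bs) D
    total : 2 + length D ≡ n + n
    rows : ∀ a → rdeg D a ≤ n
    cols : ∀ x → cdeg D x ≤ n

Solvable : ℕ → Set₁
Solvable n = ∀ {N} {As Bs : List (Fin N)} {D} → Instance n As Bs D → Routed (Box As Bs) D

instance-↭ : ∀ {n} {As As′ Bs Bs′ : List (Fin N)} {D D′} → As ↭ As′ → Bs ↭ Bs′ → D ↭ D′ →
  Instance n As Bs D → Instance n As′ Bs′ D′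
instance-↭ p q r I = record
  { unA = unique-↭ p unA ; unB = unique-↭ q unB
  ; lenA = trans (sym (↭-length p)) lenA ; lenB = trans (sym (↭-length q)) lenB
  ; box = All.map (box-↭ p q) (All-resp-↭ r box)
  ; total = trans (cong (2 +_) (sym (↭-length r))) total
  ; rows = λ a → ≤-trans (≤-reflexive (sym (count-↭ proj₁ r))) (rows a)
  ; cols = λ x → ≤-trans (≤-reflexive (sym (count-↭ proj₂ r))) (cols x) }
  where open Instance I

routed-↭ : {As As′ Bs Bs′ : List (Fin N)} {D D′ : Demands N} → As ↭ As′ → Bs ↭ Bs′ → D ↭ D′ →
  Routed (Box As′ Bs′) D′ → Routed (Box As Bs) D
routed-↭ p q r = permute (↭-sym r) ∘ weaken (box-↭ (↭-sym p) (↭-sym q))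

instance-swap : ∀ {n} {As Bs : List (Fin N)} {D} → Instance n As Bs D → Instance n Bs As (map swap D)
instance-swap {D = D} I = record
  { unA = unB ; unB = unA ; lenA = lenB ; lenB = lenA ; box = swap-box box
  ; total = trans (cong (2 +_) (length-map swap D)) total
  ; rows = λ a → ≤-trans (≤-reflexive (count-map proj₁ swap a D)) (cols a)
  ; cols = λ x → ≤-trans (≤-reflexive (count-map proj₂ swap x D)) (rows x) }
  where open Instance I

routed-swap : {As Bs : List (Fin N)} {D : Demands N} → Routed (Box Bs As) (map swap D) → Routed (Box As Bs) D
routed-swap {D = D} r = subst (Routed _) (swap-swap D) (weaken swap (swap-routed r))

-- Deleting vertices according to a plan

unique-⊆-length : {xs ys : List (Fin N)} → Unique ys → All (_∈ xs) ys → length ys ≤ length xs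
unique-⊆-length []        []       = z≤n
unique-⊆-length {xs = xs} {y ∷ ys} (y∉ ∷ un) (y∈ ∷ ys⊆)
  with extract (_≟ y) xs
... | inj₂ none = ⊥-elim (All.lookup none y∈ refl)
... | inj₁ (_ , xs′ , refl , perm) = ≤-trans
  (s≤s (unique-⊆-length un (All.tabulate λ z∈ → drop (All.lookup y∉ z∈) (∈-resp-↭ perm (All.lookup ys⊆ z∈)))))
  (≤-reflexive (sym (↭-length perm)))
  where
  drop : ∀ {z} → y ≢ z → z ∈ y ∷ xs′ → z ∈ xs′
  drop y≢z (here eq)  = ⊥-elim (y≢z (sym eq))
  drop y≢z (there z∈) = z∈

fresh : {xs ys : List (Fin N)} → Unique ys → length xs < length ys → ∃ λ y → y ∈ ys × y ∉ xs
fresh {xs = xs} {ys} un len with extract (λ y → ¬? (mem? _≟_ y xs)) ys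
... | inj₁ (y , _ , y∉ , perm) = y , ∈-resp-↭ (↭-sym perm) (here refl) , y∉
... | inj₂ none = ⊥-elim (1+n≰n (≤-trans len
  (unique-⊆-length un (All.map (λ {y} → decidable-stable (mem? _≟_ y xs)) none))))

count-bounded : (key : X → Fin N) {Vs : List (Fin N)} {D : List X} {k : ℕ} → All (λ d → key d ∈ Vs) D →
  (∀ {v} → v ∈ Vs → count key v D ≤ k) → ∀ v → count key v D ≤ k
count-bounded key {Vs} {D} keys bound v with mem? _≟_ v Vs
... | yes v∈ = bound v∈
... | no  v∉ = ≤-trans (≤-reflexive (count-absent key (All.map (λ { v∈ refl → v∉ v∈ }) keys))) z≤n

unique-++-disjoint : (xs : List X) {ys : List X} → Unique (xs ++ ys) → ∀ {x} → x ∈ xs → x ∉ ys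
unique-++-disjoint (x ∷ xs) (x∉ ∷ un) (here refl) x∈ = All.lookup x∉ (∈-++⁺ʳ xs x∈) refl
unique-++-disjoint (x ∷ xs) (x∉ ∷ un) (there x∈)     = unique-++-disjoint xs un x∈

unique-prefix : (xs : List X) {ys : List X} → Unique (xs ++ ys) → Unique xs
unique-prefix []       _         = []
unique-prefix (x ∷ xs) (x∉ ∷ un) = All.++⁻ˡ xs x∉ ∷ unique-prefix xs un

unique-++ʳ : (xs : List X) {ys : List X} → Unique (xs ++ ys) → Unique ys
unique-++ʳ []       un       = un
unique-++ʳ (x ∷ xs) (_ ∷ un) = unique-++ʳ xs un

-- A plan pairs each deleted vertex b with the vertices F that cannot be lowered through b.  Unless
-- all degrees are small anyway, F consists of ends of deleted demands, one degree lower already.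
Plan : ℕ → Set
Plan N = List (Fin N × List (Fin N))

ends : Plan N → List (Fin N)
ends = concatMap proj₂

Covers : List (Edge (Fin N)) → List (Fin N) → Plan N → Set
Covers K As = All λ (b , F) → length F ≤ 2 × (∀ {v} → v ∈ As → (v , b) ∈ K → v ∈ F)

module _ {K : List (Edge (Fin N))} {As : List (Fin N)} where

  -- The at most two entries of `F` together with `v` exclude three vertices, so a fourth one is
  -- available.
  covers-spare : Unique As → 4 ≤ length As → ∀ {Rs} → Covers K As Rs →
    ∀ {b} → b ∈ map proj₁ Rs → ∀ v → ∃ λ c → c ∈ As × c ≢ v × (c , b) ∉ K
  covers-spare un 4≤ ((F≤ , F⊇) ∷ _) (here refl) v
    with c , c∈ , c∉ ← fresh un (≤-trans (s≤s (s≤s F≤)) 4≤) =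
    c , c∈ , c∉ ∘ here , c∉ ∘ there ∘ F⊇ c∈
  covers-spare un 4≤ (_ ∷ cs) (there b∈) v = covers-spare un 4≤ cs b∈ v

  -- Each deleted vertex is either still free for `v` or has `v` in its list `F`.
  covers-free : ∀ {v} → v ∈ As → ∀ {Rs} → Covers K As Rs →
    length Rs ≤ count id v (ends Rs) + free K (map proj₁ Rs) v
  covers-free v∈ [] = z≤n
  covers-free {v} v∈ {(b , F) ∷ Rs} ((_ , F⊇) ∷ cs) with (v , b) ∈? K
  ... | no _ = begin
    suc (length Rs)                          ≤⟨ s≤s (covers-free v∈ cs) ⟩
    suc (count id v (ends Rs) + f)           ≤⟨ s≤s (+-monoˡ-≤ f (m≤n+m _ (count id v F))) ⟩
    suc (count id v F + count id v (ends Rs) + f)  ≡⟨ cong (λ m → suc (m + f)) (count-++ id F) ⟨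
    suc (count id v (F ++ ends Rs) + f)      ≡⟨ +-suc _ f ⟨
    count id v (F ++ ends Rs) + suc f        ∎
    where
    open ≤-Reasoning
    f = free K (map proj₁ Rs) v
  ... | yes e∈ = ≤-trans (+-mono-≤ (count-∈ id (F⊇ v∈ e∈)) (covers-free v∈ cs))
        (≤-reflexive (trans (sym (+-assoc (count id v F) _ _)) (cong (_+ _) (sym (count-++ id F)))))

  -- In the first alternative the degree that `v` loses with `E` is its number of occurrences in
  -- `ends Rs`; by `covers-free` the free deleted vertices make up for the rest of `length Rs`.
  covers-bound : (key : X → Fin N) {E D : List X} {k : ℕ} {Rs : Plan N} → Covers K As Rs →
    (∀ v → count key v (E ++ D) ≤ length Rs + k) →
    map key E ↭ ends Rs ⊎ (∀ {v} → v ∈ As → count key v D ≤ k) →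
    ∀ {v} → v ∈ As → count key v D ≤ k + free K (map proj₁ Rs) v
  covers-bound key _  _     (inj₂ small) v∈ = ≤-trans (small v∈) (m≤m+n _ _)
  covers-bound key {E} {D} {k} {Rs} cs bound (inj₁ perm) {v} v∈ = +-cancelˡ-≤ (count key v E) _ _ (begin
    count key v E + count key v D   ≡⟨ count-++ key E ⟨
    count key v (E ++ D)            ≤⟨ bound v ⟩
    length Rs + k                   ≤⟨ +-monoˡ-≤ k (covers-free v∈ cs) ⟩
    count id v (ends Rs) + f + k    ≡⟨ cong (λ m → m + f + k) (trans (sym (count-↭ id perm)) (count-map id key v E)) ⟩
    count key v E + f + k           ≡⟨ +-assoc (count key v E) f k ⟩
    count key v E + (f + k)         ≡⟨ cong (count key v E +_) (+-comm f k) ⟩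
    count key v E + (k + f)         ∎)
    where
    open ≤-Reasoning
    f = free K (map proj₁ Rs) v

-- `Rs` is named after the rows it lowers, so its deleted vertices `bs` are columns; dually for
-- `Cs`. Four disjoint edge sets are used: `K` for `E`, links from `As` to `bs`, links from `as` to
-- `Bs`, and the box of the survivors for the induction hypothesis.
reduce : ∀ {k} → 4 ≤ k → Solvable k → (Rs Cs : Plan N) → length Rs ≡ length Cs →
  ∀ {As Bs E D K} →
  Instance (length Rs + k) (map proj₁ Cs ++ As) (map proj₁ Rs ++ Bs) (E ++ D) →
  length E ≡ length Rs + length Rs → All (Box As Bs) D →
  Routed (_∈ K) E →
  All (λ e → Box (map proj₁ Cs ++ As) (map proj₁ Rs ++ Bs) e × ¬ Box As Bs e) K →
  Covers K As Rs → Covers (map swap K) Bs Cs →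
  map proj₁ E ↭ ends Rs ⊎ (∀ {v} → v ∈ As → rdeg D v ≤ k) →
  map proj₂ E ↭ ends Cs ⊎ (∀ {w} → w ∈ Bs → cdeg D w ≤ k) →
  Routed (Box (map proj₁ Cs ++ As) (map proj₁ Rs ++ Bs)) (E ++ D)
reduce {N} {k} 4≤k IH Rs Cs lenRC {As} {Bs} {E} {D} {K} I lenE box rE K⊆ covR covC budR budC =
  weaken final (append disjoint rE rD)
  where
  module I = Instance I
  as bs : List (Fin N)
  as = map proj₁ Cs
  bs = map proj₁ Rs
  lenA : length As ≡ k
  lenA = +-cancelˡ-≡ (length Rs) _ _ (trans (cong (_+ length As) (trans lenRC (sym (length-map proj₁ Cs))))
    (trans (sym (length-++ as)) I.lenA))
  lenB : length Bs ≡ k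
  lenB = +-cancelˡ-≡ (length Rs) _ _ (trans (cong (_+ length Bs) (sym (length-map proj₁ Rs)))
    (trans (sym (length-++ bs)) I.lenB))
  unA = unique-++ʳ as I.unA
  unB = unique-++ʳ bs I.unB
  totalD : 2 + length D ≡ k + k
  totalD = +-cancelˡ-≡ (length Rs + length Rs) _ _ (begin
    length Rs + length Rs + (2 + length D)  ≡⟨ cong (_+ (2 + length D)) lenE ⟨
    length E + (2 + length D)               ≡⟨ shuffle (length E) (length D) ⟩
    2 + (length E + length D)               ≡⟨ cong (2 +_) (length-++ E) ⟨
    2 + length (E ++ D)                     ≡⟨ I.total ⟩
    length Rs + k + (length Rs + k)         ≡⟨ shuffle′ (length Rs) k ⟩
    length Rs + length Rs + (k + k)         ∎)
    where
    open ≡-Reasoning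
    shuffle : ∀ e d → e + (2 + d) ≡ 2 + (e + d)
    shuffle = solve-∀
    shuffle′ : ∀ r k → r + k + (r + k) ≡ r + r + (k + k)
    shuffle′ = solve-∀
  len≤ : length D ≤ k + k
  len≤ = ≤-trans (m≤n+m _ 2) (≤-reflexive totalD)
  bound-cols : ∀ {w} → w ∈ Bs → cdeg D w ≤ k + free (map swap K) as w
  bound-cols = covers-bound proj₂ {E} {D} covC (λ w → ≤-trans (I.cols w) (≤-reflexive (cong (_+ k) lenRC))) budC
  module L = Lowering (lower {K = K} (unique-prefix bs I.unB) box len≤
    (covers-bound proj₁ {E} {D} covR I.rows budR) (covers-spare unA (≤-trans 4≤k (≤-reflexive (sym lenA))) covR))
  swapped : Lowering Bs As as (map swap K) k (map swap L.D′)
  swapped = lower (unique-prefix as I.unA) (swap-box L.box)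
    (≤-trans (≤-reflexive (trans (length-map swap L.D′) L.len)) len≤)
    (λ {w} w∈ → ≤-trans (≤-reflexive (trans (count-map proj₁ swap w L.D′) (L.cols w))) (bound-cols w∈))
    (covers-spare unB (≤-trans 4≤k (≤-reflexive (sym lenB))) covC)
  module L′ = Lowering swapped
  -- The classes are still exchanged here; `r₁` exchanges them back after the induction hypothesis.
  I′ : Instance k Bs As L′.D′
  I′ = record
    { unA = unB ; unB = unA ; lenA = lenB ; lenB = lenA ; box = L′.box
    ; total = trans (cong (2 +_) (trans L′.len (trans (length-map swap L.D′) L.len))) totalD
    ; rows = count-bounded proj₁ (All.map proj₁ L′.box) L′.rows
    ; cols = count-bounded proj₂ (All.map proj₂ L′.box) λ {x} x∈ →
        ≤-trans (≤-reflexive (trans (L′.cols x) (count-map proj₂ swap x L.D′))) (L.rows x∈) }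
  Inner : Edge (Fin N) → Set
  Inner e = Box As Bs e ⊎ Link Bs as (map swap K) (swap e)
  r₁ : Routed Inner L.D′
  r₁ = subst (Routed Inner) (swap-swap L.D′) (weaken (λ { (inj₁ p) → inj₁ (swap p) ; (inj₂ l) → inj₂ l })
    (swap-routed (L′.routed {Box Bs As} (λ a∈ (_ , a∈As) → unique-++-disjoint as I.unA a∈ a∈As) (IH I′))))
  rD : Routed (λ e → Inner e ⊎ Link As bs K e) D
  rD = L.routed (λ { b∈ (inj₁ (_ , b∈Bs)) → unique-++-disjoint bs I.unB b∈ b∈Bs
                   ; b∈ (inj₂ (b∈Bs , _)) → unique-++-disjoint bs I.unB b∈ b∈Bs }) r₁
  disjoint : ∀ {e} → e ∈ K → ¬ (Inner e ⊎ Link As bs K e)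
  disjoint e∈ (inj₁ (inj₁ b))            = proj₂ (All.lookup K⊆ e∈) b
  disjoint e∈ (inj₁ (inj₂ (_ , _ , e∉))) = e∉ (∈-map⁺ swap e∈)
  disjoint e∈ (inj₂ (_ , _ , e∉))        = e∉ e∈
  final : ∀ {e} → e ∈ K ⊎ Inner e ⊎ Link As bs K e → Box (as ++ As) (bs ++ Bs) e
  final (inj₁ e∈)                               = proj₁ (All.lookup K⊆ e∈)
  final (inj₂ (inj₁ (inj₁ (a∈ , x∈))))          = ∈-++⁺ʳ as a∈ , ∈-++⁺ʳ bs x∈
  final (inj₂ (inj₁ (inj₂ (x∈ , a∈ , _))))      = ∈-++⁺ˡ a∈ , ∈-++⁺ʳ bs x∈
  final (inj₂ (inj₂ (a∈ , x∈ , _)))             = ∈-++⁺ʳ as a∈ , ∈-++⁺ˡ x∈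

-- A form for explicit `K`: the conditions on occupied edges become `All` statements over `K`,
-- checked edge by edge.
reduce′ : ∀ {k} → 4 ≤ k → Solvable k → (Rs Cs : Plan N) → length Rs ≡ length Cs →
  ∀ {As Bs E D K} →
  Instance (length Rs + k) (map proj₁ Cs ++ As) (map proj₁ Rs ++ Bs) (E ++ D) →
  length E ≡ length Rs + length Rs → All (Box As Bs) D →
  Routed (_∈ K) E →
  All (λ e → Box (map proj₁ Cs ++ As) (map proj₁ Rs ++ Bs) e × (proj₁ e ∈ map proj₁ Cs ⊎ proj₂ e ∈ map proj₁ Rs)) K →
  All (λ (b , F) → length F ≤ 2 × All (λ e → proj₂ e ≡ b → proj₁ e ∈ As → proj₁ e ∈ F) K) Rs →
  All (λ (a , F) → length F ≤ 2 × All (λ e → proj₁ e ≡ a → proj₂ e ∈ Bs → proj₂ e ∈ F) K) Cs →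
  map proj₁ E ↭ ends Rs ⊎ (∀ {v} → v ∈ As → rdeg D v ≤ k) →
  map proj₂ E ↭ ends Cs ⊎ (∀ {w} → w ∈ Bs → cdeg D w ≤ k) →
  Routed (Box (map proj₁ Cs ++ As) (map proj₁ Rs ++ Bs)) (E ++ D)
reduce′ 4≤k IH Rs Cs len I lenE boxD rE K⊆ covR covC =
  reduce 4≤k IH Rs Cs len I lenE boxD rE
    (All.map (λ { (inBox , inj₁ a∈) → inBox , λ (a∈As , _) → unique-++-disjoint (map proj₁ Cs) unA a∈ a∈As
                ; (inBox , inj₂ b∈) → inBox , λ (_ , b∈Bs) → unique-++-disjoint (map proj₁ Rs) unB b∈ b∈Bs }) K⊆)
    (All.map (λ (F≤ , F⊇) → F≤ , λ {_} v∈ e∈ → All.lookup F⊇ e∈ refl v∈) covR)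
    (All.map (λ (F≤ , F⊇) → F≤ , λ {_} v∈ e∈ → case ∈-map⁻ swap e∈ of λ { (_ , e∈ , refl) → All.lookup F⊇ e∈ refl v∈ }) covC)
  where open Instance I

box-tail : ∀ {a b} {As Bs : List (Fin N)} {D} → All (Box (a ∷ As) (b ∷ Bs)) D →
  All (λ e → proj₁ e ≢ a) D → All (λ e → proj₂ e ≢ b) D → All (Box As Bs) D
box-tail []                 []         []         = []
box-tail ((a∈ , b∈) ∷ box) (a≢ ∷ as≢) (b≢ ∷ bs≢) = (tail a≢ a∈ , tail b≢ b∈) ∷ box-tail box as≢ bs≢
  where
  tail : ∀ {x y : X} {xs} → x ≢ y → x ∈ y ∷ xs → x ∈ xs
  tail x≢ (here eq)  = ⊥-elim (x≢ eq)
  tail _  (there x∈) = x∈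

-- Explicit routings of the deleted demands

by-row : {e e′ : Edge (Fin N)} → proj₁ e ≢ proj₁ e′ → e ≢ e′
by-row neq = neq ∘ cong proj₁

by-col : {e e′ : Edge (Fin N)} → proj₂ e ≢ proj₂ e′ → e ≢ e′
by-col neq = neq ∘ cong proj₂

-- Disjointness of explicit trails is certified by uniqueness of their concatenation.
routed-∷ : ∀ {a x} {es K : List (Edge X)} {D} → Trail a x es → Unique (es ++ K) →
  Routed (_∈ K) D → Routed (_∈ es ++ K) ((a , x) ∷ D)
routed-∷ {es = es} t un r = (t , All.tabulate ∈-++⁺ˡ) ∷
  weaken (λ e∈ → ∈-++⁺ʳ es e∈ , λ e∈es → unique-++-disjoint es un e∈es e∈) r

-- With one deleted vertex per class, its list `F` can hold the ends of both demands, and the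
-- accounting of ends is trivial.
reduce₁ : ∀ {k} → 4 ≤ k → Solvable k → ∀ {a b} {As Bs : List (Fin N)} {e₁ e₂ D K} →
  Instance (suc k) (a ∷ As) (b ∷ Bs) (e₁ ∷ e₂ ∷ D) →
  All (λ e → proj₁ e ≢ a) D → All (λ e → proj₂ e ≢ b) D →
  Routed (_∈ K) (e₁ ∷ e₂ ∷ []) →
  All (λ e → Box (a ∷ As) (b ∷ Bs) e × (proj₁ e ∈ a ∷ [] ⊎ proj₂ e ∈ b ∷ [])) K →
  All (λ e → proj₂ e ≡ b → proj₁ e ∈ As → proj₁ e ∈ proj₁ e₁ ∷ proj₁ e₂ ∷ []) K →
  All (λ e → proj₁ e ≡ a → proj₂ e ∈ Bs → proj₂ e ∈ proj₂ e₁ ∷ proj₂ e₂ ∷ []) K →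
  Routed (Box (a ∷ As) (b ∷ Bs)) (e₁ ∷ e₂ ∷ D)
reduce₁ 4≤k IH {a} {b} {e₁ = e₁} {e₂} I D≢a D≢b rE K⊆ covR covC =
  reduce′ 4≤k IH ((b , proj₁ e₁ ∷ proj₁ e₂ ∷ []) ∷ []) ((a , proj₂ e₁ ∷ proj₂ e₂ ∷ []) ∷ []) refl
    I refl (box-tail (All.tail (All.tail box)) D≢a D≢b) rE K⊆
    ((≤-refl , covR) ∷ []) ((≤-refl , covC) ∷ []) (inj₁ ↭-refl) (inj₁ ↭-refl)
  where open Instance I

module _ (key : X → Fin N) {v : Fin N} {d : X} {D D′ : List X} (perm : D ↭ d ∷ D′) where

  count-rest-≡ : ∀ {m} → key d ≡ v → count key v D ≡ suc m → count key v D′ ≡ m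
  count-rest-≡ eq c = suc-injective (trans (sym (count-≡ key eq)) (trans (sym (count-↭ key perm)) c))

  count-rest-≢ : key d ≢ v → count key v D′ ≡ count key v D
  count-rest-≢ neq = sym (trans (count-↭ key perm) (count-≢ key neq))

-- As `(a , b)` is no demand, the demands at `a` and at `b` are two different ones; each is routed
-- by its own edge.
resolve-leaves : ∀ {k} → 4 ≤ k → Solvable k → ∀ {a b} {As Bs : List (Fin N)} {D} →
  Instance (suc k) (a ∷ As) (b ∷ Bs) D → rdeg D a ≡ 1 → cdeg D b ≡ 1 → (a , b) ∉ D →
  Routed (Box (a ∷ As) (b ∷ Bs)) D
resolve-leaves 4≤k IH {a} {b} {D = D} I da db ab∉
  with (_ , x) , D₁ , refl , p₁ ← count-pos proj₁ {a} {D} (≤-reflexive (sym da))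
  with x≢b ← (x ≢ b ∋ λ { refl → ab∉ (∈-resp-↭ (↭-sym p₁) (here refl)) })
  with (y , _) , D₂ , refl , p₂ ← count-pos proj₂ {b} {D₁}
         (≤-reflexive (sym (trans (count-rest-≢ proj₂ p₁ x≢b) db)))
  with y≢a ∷ D₂≢a ← All-resp-↭ p₂ (count-zero proj₁ {a} {D₁} (count-rest-≡ proj₁ p₁ refl da)) =
  routed-↭ ↭-refl ↭-refl p
    (reduce₁ 4≤k IH I′ D₂≢a (count-zero proj₂ (count-rest-≡ proj₂ p₂ refl (trans (count-rest-≢ proj₂ p₁ x≢b) db)))
      (routed-∷ direct ((by-row (y≢a ∘ sym) ∷ []) ∷ [] ∷ []) (routed-∷ direct ([] ∷ []) []))
      ((All.head I′.box , inj₁ (here refl)) ∷ (All.head (All.tail I′.box) , inj₂ (here refl)) ∷ [])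
      ((λ _ _ → here refl) ∷ (λ _ _ → there (here refl)) ∷ [])
      ((λ _ _ → here refl) ∷ (λ _ _ → there (here refl)) ∷ []))
  where
  p = ↭-trans p₁ (↭-prep _ p₂)
  I′ = instance-↭ ↭-refl ↭-refl p I
  module I′ = Instance I′

-- The demand (y , x′) takes the path y - b - a - x′, unless y = a.
resolve-corner : ∀ {k} → 4 ≤ k → Solvable k → ∀ {a b x y x′} {As Bs : List (Fin N)} {D} →
  Instance (suc k) (a ∷ As) (b ∷ Bs) ((a , x) ∷ (y , x′) ∷ D) →
  All (λ e → proj₁ e ≢ a) D → All (λ e → proj₂ e ≢ b) ((a , x) ∷ (y , x′) ∷ D) → x ≢ x′ →
  Routed (Box (a ∷ As) (b ∷ Bs)) ((a , x) ∷ (y , x′) ∷ D)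
resolve-corner 4≤k IH {a} {b} {x} {y} {x′} I D≢a (x≢b ∷ x′≢b ∷ D≢b) x≢x′ with y ≟ a
... | yes refl = reduce₁ 4≤k IH I D≢a D≢b
  (routed-∷ direct ((by-col x≢x′ ∷ []) ∷ [] ∷ []) (routed-∷ direct ([] ∷ []) []))
  ((All.head box , inj₁ (here refl)) ∷ (All.head (All.tail box) , inj₁ (here refl)) ∷ [])
  ((λ _ _ → here refl) ∷ (λ _ _ → here refl) ∷ [])
  ((λ _ _ → here refl) ∷ (λ _ _ → there (here refl)) ∷ [])
  where open Instance I
... | no y≢a = reduce₁ 4≤k IH I D≢a D≢b
  (routed-∷ direct
    ((by-row (≢-sym y≢a) ∷ by-col x≢b ∷ by-col x≢x′ ∷ []) ∷ un)
    (routed-∷ (detour direct) un []))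
  ((ax∈ , inj₁ (here refl)) ∷ ((proj₁ yx∈ , here refl) , inj₂ (here refl)) ∷
   ((here refl , here refl) , inj₁ (here refl)) ∷ ((here refl , proj₂ yx∈) , inj₁ (here refl)) ∷ [])
  ((λ _ _ → here refl) ∷ (λ _ _ → there (here refl)) ∷ (λ _ _ → here refl) ∷ (λ _ _ → here refl) ∷ [])
  ((λ _ _ → here refl) ∷ (λ y≡a _ → ⊥-elim (y≢a y≡a)) ∷
   (λ _ b∈ → ⊥-elim (unique-++-disjoint (b ∷ []) unB (here refl) b∈)) ∷ (λ _ _ → there (here refl)) ∷ [])
  where
  open Instance I
  ax∈ = All.head box
  yx∈ = All.head (All.tail box)
  un : Unique ((y , b) ∷ (a , b) ∷ (a , x′) ∷ [])
  un = (by-row y≢a ∷ by-row y≢a ∷ []) ∷ (by-col (≢-sym x′≢b) ∷ []) ∷ [] ∷ []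

-- The four demands pass through the edges (b , a), (b , a′), (b′ , a′), (b′ , a) in this order;
-- the inequalities say that demands which meet in b, b′, a or a′ use different edges there.
resolve-quad : ∀ {k} → 4 ≤ k → Solvable k → ∀ {a a′ b b′ p₁ p₂ p₃ p₄ x₁ x₂ x₃ x₄} {As Bs : List (Fin N)} {D₀} →
  let D = (p₁ , x₁) ∷ (p₂ , x₂) ∷ (p₃ , x₃) ∷ (p₄ , x₄) ∷ D₀ in
  Instance (2 + k) (a ∷ a′ ∷ As) (b ∷ b′ ∷ Bs) D →
  All (λ e → proj₁ e ≢ a) D → All (λ e → proj₁ e ≢ a′) D →
  All (λ e → proj₂ e ≢ b) D → All (λ e → proj₂ e ≢ b′) D →
  p₁ ≢ p₂ → p₃ ≢ p₄ → x₁ ≢ x₄ → x₂ ≢ x₃ →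
  Routed (Box (a ∷ a′ ∷ As) (b ∷ b′ ∷ Bs)) D
resolve-quad {N} 4≤k IH {a} {a′} {b} {b′} {p₁} {p₂} {p₃} {p₄} {x₁} {x₂} {x₃} {x₄} {As} {Bs} I
  (p₁≢a ∷ p₂≢a ∷ p₃≢a ∷ p₄≢a ∷ D≢a) (p₁≢a′ ∷ p₂≢a′ ∷ p₃≢a′ ∷ p₄≢a′ ∷ D≢a′)
  (x₁≢b ∷ x₂≢b ∷ x₃≢b ∷ x₄≢b ∷ D≢b) (x₁≢b′ ∷ x₂≢b′ ∷ x₃≢b′ ∷ x₄≢b′ ∷ D≢b′)
  p₁≢p₂ p₃≢p₄ x₁≢x₄ x₂≢x₃ with Instance.box I
... | (p₁∈ , x₁∈) ∷ (p₂∈ , x₂∈) ∷ (p₃∈ , x₃∈) ∷ (p₄∈ , x₄∈) ∷ box₀ =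
  reduce′ 4≤k IH ((b , p₁ ∷ p₂ ∷ []) ∷ (b′ , p₃ ∷ p₄ ∷ []) ∷ []) ((a , x₁ ∷ x₄ ∷ []) ∷ (a′ , x₂ ∷ x₃ ∷ []) ∷ [])
    refl I refl (box-tail (box-tail box₀ D≢a D≢b) D≢a′ D≢b′) rE K⊆
    ((≤-refl ,
      (λ _ _ → here refl) ∷ (λ _ → a∉) ∷ (λ _ → a∉) ∷
      (λ _ _ → there (here refl)) ∷ (λ _ → a′∉) ∷ (λ _ → a′∉) ∷
      ≠b′ ∷ ≠b′ ∷ (λ _ → a′∉) ∷ ≠b′ ∷ ≠b′ ∷ (λ _ → a∉) ∷ []) ∷
     (≤-refl ,
      ≠b ∷ ≠b ∷ (λ _ → a∉) ∷ ≠b ∷ ≠b ∷ (λ _ → a′∉) ∷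
      (λ _ _ → here refl) ∷ (λ _ → a′∉) ∷ (λ _ → a′∉) ∷
      (λ _ _ → there (here refl)) ∷ (λ _ → a∉) ∷ (λ _ → a∉) ∷ []) ∷ [])
    ((≤-refl ,
      (λ _ → b∉) ∷ (λ _ → b∉) ∷ (λ _ _ → here refl) ∷
      (λ _ → b∉) ∷ (λ _ → b∉) ∷ ≠a′ ∷
      (λ _ → b′∉) ∷ (λ _ → b′∉) ∷ ≠a′ ∷
      (λ _ → b′∉) ∷ (λ _ → b′∉) ∷ (λ _ _ → there (here refl)) ∷ []) ∷
     (≤-refl ,
      (λ _ → b∉) ∷ (λ _ → b∉) ∷ ≠a ∷
      (λ _ → b∉) ∷ (λ _ → b∉) ∷ (λ _ _ → here refl) ∷
      (λ _ → b′∉) ∷ (λ _ → b′∉) ∷ (λ _ _ → there (here refl)) ∷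
      (λ _ → b′∉) ∷ (λ _ → b′∉) ∷ ≠a ∷ []) ∷ [])
    -- The trails leave `a` towards `x₁` and `x₄`, and `a′` towards `x₂` and `x₃`; hence the
    -- reordering of the column ends.
    (inj₁ ↭-refl) (inj₁ (↭-prep x₁ (++-comm (x₂ ∷ x₃ ∷ []) (x₄ ∷ []))))
  where
  module I = Instance I
  as bs : List (Fin N)
  as = a ∷ a′ ∷ []
  bs = b ∷ b′ ∷ []
  a≢a′ : a ≢ a′
  a≢a′ = All.head (AllPairs.head I.unA)
  b≢b′ : b ≢ b′
  b≢b′ = All.head (AllPairs.head I.unB)
  a∉ : {P : Set} → a ∈ As → P
  a∉ a∈ = ⊥-elim (unique-++-disjoint as I.unA (here refl) a∈)
  a′∉ : {P : Set} → a′ ∈ As → P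
  a′∉ a∈ = ⊥-elim (unique-++-disjoint as I.unA (there (here refl)) a∈)
  b∉ : {P : Set} → b ∈ Bs → P
  b∉ b∈ = ⊥-elim (unique-++-disjoint bs I.unB (here refl) b∈)
  b′∉ : {P : Set} → b′ ∈ Bs → P
  b′∉ b∈ = ⊥-elim (unique-++-disjoint bs I.unB (there (here refl)) b∈)
  ≠b′ : {P : Set} → b′ ≡ b → P
  ≠b′ eq = ⊥-elim (b≢b′ (sym eq))
  ≠b : {P : Set} → b ≡ b′ → P
  ≠b eq = ⊥-elim (b≢b′ eq)
  ≠a′ : {P : Set} → a′ ≡ a → P
  ≠a′ eq = ⊥-elim (a≢a′ (sym eq))
  ≠a : {P : Set} → a ≡ a′ → P
  ≠a eq = ⊥-elim (a≢a′ eq)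
  E₁ E₂ E₃ E₄ K : List (Edge (Fin N))
  E₁ = (p₁ , b) ∷ (a , b) ∷ (a , x₁) ∷ []
  E₂ = (p₂ , b) ∷ (a′ , b) ∷ (a′ , x₂) ∷ []
  E₃ = (p₃ , b′) ∷ (a′ , b′) ∷ (a′ , x₃) ∷ []
  E₄ = (p₄ , b′) ∷ (a , b′) ∷ (a , x₄) ∷ []
  K = E₁ ++ E₂ ++ E₃ ++ E₄
  un₄ : Unique E₄
  un₄ = (by-row p₄≢a ∷ by-row p₄≢a ∷ []) ∷ (by-col (≢-sym x₄≢b′) ∷ []) ∷ [] ∷ []
  un₃ : Unique (E₃ ++ E₄)
  un₃ =
    (by-row p₃≢a′ ∷ by-row p₃≢a′ ∷ by-row p₃≢p₄ ∷ by-row p₃≢a ∷ by-row p₃≢a ∷ []) ∷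
    (by-col (≢-sym x₃≢b′) ∷ by-row (≢-sym p₄≢a′) ∷ by-row (≢-sym a≢a′) ∷ by-row (≢-sym a≢a′) ∷ []) ∷
    (by-row (≢-sym p₄≢a′) ∷ by-row (≢-sym a≢a′) ∷ by-row (≢-sym a≢a′) ∷ []) ∷ un₄
  un₂ : Unique (E₂ ++ E₃ ++ E₄)
  un₂ =
    (by-row p₂≢a′ ∷ by-row p₂≢a′ ∷ by-col b≢b′ ∷ by-col b≢b′ ∷ by-row p₂≢a′ ∷
     by-col b≢b′ ∷ by-col b≢b′ ∷ by-row p₂≢a ∷ []) ∷
    (by-col (≢-sym x₂≢b) ∷ by-col b≢b′ ∷ by-col b≢b′ ∷ by-col (≢-sym x₃≢b) ∷
     by-col b≢b′ ∷ by-col b≢b′ ∷ by-row (≢-sym a≢a′) ∷ []) ∷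
    (by-row (≢-sym p₃≢a′) ∷ by-col x₂≢b′ ∷ by-col x₂≢x₃ ∷
     by-row (≢-sym p₄≢a′) ∷ by-row (≢-sym a≢a′) ∷ by-row (≢-sym a≢a′) ∷ []) ∷ un₃
  un₁ : Unique K
  un₁ =
    (by-row p₁≢a ∷ by-row p₁≢a ∷ by-row p₁≢p₂ ∷ by-row p₁≢a′ ∷ by-row p₁≢a′ ∷
     by-col b≢b′ ∷ by-col b≢b′ ∷ by-row p₁≢a′ ∷ by-col b≢b′ ∷ by-col b≢b′ ∷ by-row p₁≢a ∷ []) ∷
    (by-col (≢-sym x₁≢b) ∷ by-row (≢-sym p₂≢a) ∷ by-row a≢a′ ∷ by-row a≢a′ ∷
     by-col b≢b′ ∷ by-col b≢b′ ∷ by-row a≢a′ ∷ by-col b≢b′ ∷ by-col b≢b′ ∷ by-col (≢-sym x₄≢b) ∷ []) ∷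
    (by-row (≢-sym p₂≢a) ∷ by-row a≢a′ ∷ by-row a≢a′ ∷ by-row (≢-sym p₃≢a) ∷ by-row a≢a′ ∷ by-row a≢a′ ∷
     by-row (≢-sym p₄≢a) ∷ by-col x₁≢b′ ∷ by-col x₁≢x₄ ∷ []) ∷ un₂
  rE : Routed (_∈ K) ((p₁ , x₁) ∷ (p₂ , x₂) ∷ (p₃ , x₃) ∷ (p₄ , x₄) ∷ [])
  rE = routed-∷ (detour direct) un₁ (routed-∷ (detour direct) un₂
    (routed-∷ (detour direct) un₃ (routed-∷ (detour direct) un₄ [])))
  1st : ∀ {y : Fin N} {ys} → y ∈ y ∷ ys
  1st = here refl
  2nd : ∀ {y z : Fin N} {ys} → z ∈ y ∷ z ∷ ys
  2nd = there (here refl)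
  K⊆ : All (λ e → Box (a ∷ a′ ∷ As) (b ∷ b′ ∷ Bs) e × (proj₁ e ∈ as ⊎ proj₂ e ∈ bs)) K
  K⊆ =
    ((p₁∈ , 1st) , inj₂ 1st) ∷ ((1st , 1st) , inj₂ 1st) ∷ ((1st , x₁∈) , inj₁ 1st) ∷
    ((p₂∈ , 1st) , inj₂ 1st) ∷ ((2nd , 1st) , inj₂ 1st) ∷ ((2nd , x₂∈) , inj₁ 2nd) ∷
    ((p₃∈ , 2nd) , inj₂ 2nd) ∷ ((2nd , 2nd) , inj₂ 2nd) ∷ ((2nd , x₃∈) , inj₁ 2nd) ∷
    ((p₄∈ , 2nd) , inj₂ 2nd) ∷ ((1st , 2nd) , inj₁ 1st) ∷ ((1st , x₄∈) , inj₁ 1st) ∷ []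

-- The second copies take the paths p - y - p′ - q and p′ - y′ - p - q′; y and y′ need not be
-- among the deleted columns b and b′.
resolve-doubles : ∀ {k} → 4 ≤ k → Solvable k → ∀ {p p′ q q′ b b′ y y′ z z′} {As Bs : List (Fin N)} {D₀} →
  let D = (p , q) ∷ (p , q) ∷ (p′ , q′) ∷ (p′ , q′) ∷ D₀ in
  Instance (2 + k) (p ∷ p′ ∷ As) (b ∷ b′ ∷ Bs) D →
  All (λ e → proj₁ e ≢ p) D₀ → All (λ e → proj₁ e ≢ p′) D₀ →
  All (λ e → proj₂ e ≢ b) D₀ → All (λ e → proj₂ e ≢ b′) D₀ →
  q ≢ q′ → y ∈ b ∷ b′ ∷ Bs → y′ ∈ b ∷ b′ ∷ Bs → y ≢ y′ → y ≢ q → y ≢ q′ → y′ ≢ q → y′ ≢ q′ →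
  (∀ {w} → w ∈ Bs → w ∈ q ∷ q′ ∷ y ∷ y′ ∷ [] → w ∈ z ∷ z′ ∷ []) →
  q ∷ q ∷ q′ ∷ q′ ∷ [] ↭ z ∷ z′ ∷ z ∷ z′ ∷ [] ⊎ (∀ {w} → w ∈ Bs → cdeg D₀ w ≤ k) →
  Routed (Box (p ∷ p′ ∷ As) (b ∷ b′ ∷ Bs)) D
resolve-doubles {N} 4≤k IH {p} {p′} {q} {q′} {b} {b′} {y} {y′} {z} {z′} {As} {Bs} I
  D≢p D≢p′ D≢b D≢b′ q≢q′ y∈ y′∈ y≢y′ y≢q y≢q′ y′≢q y′≢q′ cover budget with Instance.box I
... | (p∈ , q∈) ∷ _ ∷ (p′∈ , q′∈) ∷ _ ∷ box₀ =
  -- All occupied edges lie at the deleted rows, so no surviving row is affected; the lists at `b`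
  -- and `b′` just reproduce the row ends of the four demands.
  reduce′ 4≤k IH ((b , p ∷ p ∷ []) ∷ (b′ , p′ ∷ p′ ∷ []) ∷ []) ((p , z ∷ z′ ∷ []) ∷ (p′ , z ∷ z′ ∷ []) ∷ [])
    refl I refl (box-tail (box-tail box₀ D≢p D≢b) D≢p′ D≢b′) rE K⊆
    ((≤-refl , All.map (λ m _ → absent m) K-rows) ∷ (≤-refl , All.map (λ m _ → absent m) K-rows) ∷ [])
    ((≤-refl , covC) ∷ (≤-refl , covC) ∷ [])
    (inj₁ ↭-refl) budget
  where
  module I = Instance I
  p≢p′ : p ≢ p′
  p≢p′ = All.head (AllPairs.head I.unA)
  E₁ E₂ E₃ E₄ K : List (Edge (Fin N))
  E₁ = (p , q) ∷ []
  E₂ = (p , y) ∷ (p′ , y) ∷ (p′ , q) ∷ []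
  E₃ = (p′ , q′) ∷ []
  E₄ = (p′ , y′) ∷ (p , y′) ∷ (p , q′) ∷ []
  K = E₁ ++ E₂ ++ E₃ ++ E₄
  pp′ : {x x′ : Fin N} → (p , x) ≢ (p′ , x′)
  pp′ = by-row p≢p′
  p′p : {x x′ : Fin N} → (p′ , x) ≢ (p , x′)
  p′p = by-row (≢-sym p≢p′)
  un₄ : Unique E₄
  un₄ = (p′p ∷ p′p ∷ []) ∷ (by-col y′≢q′ ∷ []) ∷ [] ∷ []
  un₃ : Unique (E₃ ++ E₄)
  un₃ = (by-col (≢-sym y′≢q′) ∷ p′p ∷ p′p ∷ []) ∷ un₄
  un₂ : Unique (E₂ ++ E₃ ++ E₄)
  un₂ =
    (pp′ ∷ pp′ ∷ pp′ ∷ pp′ ∷ by-col y≢y′ ∷ by-col y≢q′ ∷ []) ∷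
    (by-col y≢q ∷ by-col y≢q′ ∷ by-col y≢y′ ∷ p′p ∷ p′p ∷ []) ∷
    (by-col q≢q′ ∷ by-col (≢-sym y′≢q) ∷ p′p ∷ p′p ∷ []) ∷ un₃
  un₁ : Unique K
  un₁ = (by-col (≢-sym y≢q) ∷ pp′ ∷ pp′ ∷ pp′ ∷ pp′ ∷ by-col (≢-sym y′≢q) ∷ by-col q≢q′ ∷ []) ∷ un₂
  rE : Routed (_∈ K) ((p , q) ∷ (p , q) ∷ (p′ , q′) ∷ (p′ , q′) ∷ [])
  rE = routed-∷ direct un₁ (routed-∷ (detour direct) un₂ (routed-∷ direct un₃ (routed-∷ (detour direct) un₄ [])))
  1st : ∀ {u : Fin N} {us} → u ∈ u ∷ us
  1st = here refl
  2nd : ∀ {u v : Fin N} {us} → v ∈ u ∷ v ∷ us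
  2nd = there (here refl)
  K-rows : All (λ e → proj₁ e ∈ p ∷ p′ ∷ []) K
  K-rows = 1st ∷ 1st ∷ 2nd ∷ 2nd ∷ 2nd ∷ 2nd ∷ 1st ∷ 1st ∷ []
  absent : ∀ {v} {P : Set} → v ∈ p ∷ p′ ∷ [] → v ∈ As → P
  absent v∈ v∈As = ⊥-elim (unique-++-disjoint (p ∷ p′ ∷ []) I.unA v∈ v∈As)
  3rd : ∀ {u v w : Fin N} {us} → w ∈ u ∷ v ∷ w ∷ us
  3rd = there 2nd
  4th : ∀ {u v w x : Fin N} {us} → x ∈ u ∷ v ∷ w ∷ x ∷ us
  4th = there 3rd
  K-cols : All (λ e → proj₂ e ∈ q ∷ q′ ∷ y ∷ y′ ∷ []) K
  K-cols = 1st ∷ 3rd ∷ 3rd ∷ 1st ∷ 2nd ∷ 4th ∷ 4th ∷ 2nd ∷ []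
  covC : ∀ {c} → All (λ e → proj₁ e ≡ c → proj₂ e ∈ Bs → proj₂ e ∈ z ∷ z′ ∷ []) K
  covC = All.map (λ m _ w∈ → cover w∈ m) K-cols
  Q = λ e → Box (p ∷ p′ ∷ As) (b ∷ b′ ∷ Bs) e × (proj₁ e ∈ p ∷ p′ ∷ [] ⊎ proj₂ e ∈ b ∷ b′ ∷ [])
  K⊆ : All Q K
  K⊆ =
    ((1st , q∈) , inj₁ 1st) ∷ ((1st , y∈) , inj₁ 1st) ∷ ((2nd , y∈) , inj₁ 2nd) ∷ ((2nd , q∈) , inj₁ 2nd) ∷
    ((2nd , q′∈) , inj₁ 2nd) ∷ ((2nd , y′∈) , inj₁ 2nd) ∷ ((1st , y′∈) , inj₁ 1st) ∷ ((1st , q′∈) , inj₁ 1st) ∷ []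

-- Finding disjoint demands and quads

-- If the first demand and one outside its row share their column, any demand outside that column is
-- disjoint from one of the two.
disjoint-pair : {D : Demands N} → 1 ≤ length D → (∀ a → rdeg D a < length D) → (∀ x → cdeg D x < length D) →
  ∃₂ λ p q → ∃₂ λ p′ q′ → ∃ λ D₀ → D ↭ (p , q) ∷ (p′ , q′) ∷ D₀ × p ≢ p′ × q ≢ q′
disjoint-pair {D = (p , q) ∷ D} _ rows cols with extract (λ e → ¬? (proj₁ e ≟ p)) D
... | inj₂ none = ⊥-elim (1+n≰n (≤-trans (rows p) (≤-reflexive (sym
  (count-all proj₁ (refl ∷ All.map (decidable-stable (_ ≟ p)) none))))))
... | inj₁ ((p₂ , q₂) , D₁ , p₂≢p , perm₁) with q₂ ≟ q
...   | no q₂≢q = p , q , p₂ , q₂ , D₁ , ↭-prep _ perm₁ , ≢-sym p₂≢p , ≢-sym q₂≢q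
...   | yes refl with extract (λ e → ¬? (proj₂ e ≟ q)) D₁
...     | inj₂ none = ⊥-elim (1+n≰n (≤-trans (cols q) (≤-reflexive (trans (↭-length (↭-prep (p , q) perm₁)) (sym
  (trans (count-↭ proj₂ (↭-prep (p , q) perm₁))
    (count-all proj₂ (refl ∷ refl ∷ All.map (decidable-stable (_ ≟ q)) none))))))))
...     | inj₁ ((p₃ , q₃) , D₂ , q₃≢q , perm₂) with p₃ ≟ p
...       | no p₃≢p = p , q , p₃ , q₃ , (p₂ , q) ∷ D₂ ,
  ↭-prep _ (↭-trans perm₁ (↭-trans (↭-prep _ perm₂) (↭.swap _ _ ↭-refl))) , ≢-sym p₃≢p , ≢-sym q₃≢q
...       | yes refl = p₂ , q , p , q₃ , (p , q) ∷ D₂ ,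
  ↭-trans (↭-prep _ (↭-trans perm₁ (↭-prep _ perm₂)))
    (↭-trans (↭.swap _ _ ↭-refl) (↭-prep _ (↭.swap _ _ ↭-refl))) , p₂≢p , ≢-sym q₃≢q

-- The inequalities are those that `resolve-quad` asks of its four demands.
Quad : Demands N → Set
Quad D = ∃₂ λ p₁ x₁ → ∃₂ λ p₂ x₂ → ∃₂ λ p₃ x₃ → ∃₂ λ p₄ x₄ → ∃ λ D₀ →
  D ↭ (p₁ , x₁) ∷ (p₂ , x₂) ∷ (p₃ , x₃) ∷ (p₄ , x₄) ∷ D₀ × p₁ ≢ p₂ × p₃ ≢ p₄ × x₁ ≢ x₄ × x₂ ≢ x₃

-- Three demands in column `q` fit into no quad with `(p′ , q′)`. But column `q′`, not having degree
-- 1, holds another demand, which replaces one of the three.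
quad-column : {D : Demands N} → (∀ x → cdeg D x ≢ 1) → ∀ {p p′ q q′ D₃} → p ≢ p′ → q ≢ q′ →
  D ↭ (p , q) ∷ (p′ , q′) ∷ (p , q) ∷ (p′ , q) ∷ D₃ → Quad D
quad-column {D = D} cols {p} {p′} {q} {q′} {D₃} p≢p′ q≢q′ perm
  with (t , _) , D₄ , refl , perm′ ← count-pos proj₂ {q′} {D₃} (n≢0⇒n>0 λ c → cols q′
    (trans (count-↭ proj₂ perm) (trans (count-≢ proj₂ q≢q′)
      (trans (count-≡ proj₂ {d = p′ , q′} {(p , q) ∷ (p′ , q) ∷ D₃} refl)
        (cong suc (trans (count-≢ proj₂ {d = p , q} {(p′ , q) ∷ D₃} q≢q′)
          (trans (count-≢ proj₂ {d = p′ , q} {D₃} q≢q′) c)))))))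
  with t ≟ p′
... | no t≢p′ = p , q , p′ , q′ , p′ , q , t , q′ , (p , q) ∷ D₄ ,
  ↭-trans perm (↭-prep _ (↭-prep _ (↭-trans (↭-prep _ (↭-prep _ perm′))
    (↭-sym (shift (p , q) ((p′ , q) ∷ (t , q′) ∷ []) D₄))))) , p≢p′ , ≢-sym t≢p′ , q≢q′ , ≢-sym q≢q′
... | yes refl = p , q , p′ , q′ , p , q , p′ , q′ , (p′ , q) ∷ D₄ ,
  ↭-trans perm (↭-prep _ (↭-prep _ (↭-prep _ (↭-trans (↭-prep _ perm′) (↭.swap _ _ ↭-refl))))) ,
  p≢p′ , p≢p′ , q≢q′ , ≢-sym q≢q′

two-rows : {D : Demands N} → ∀ {p q p′ q′ D₁} → D ↭ (p , q) ∷ (p′ , q′) ∷ D₁ → p ≢ p′ →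
  rdeg D p ≢ 1 → rdeg D p′ ≢ 1 →
  ∃₂ λ r r′ → ∃ λ D₃ → D ↭ (p , q) ∷ (p′ , q′) ∷ (p , r) ∷ (p′ , r′) ∷ D₃
two-rows {D = D} {p} {q} {p′} {q′} {D₁} perm₁ p≢p′ ≢1 ≢1′
  with (_ , r) , D₂ , refl , perm₂ ← count-pos proj₁ {p} {D₁} (n≢0⇒n>0 λ c → ≢1
    (trans (count-↭ proj₁ perm₁) (trans (count-≡ proj₁ {d = p , q} {(p′ , q′) ∷ D₁} refl)
      (cong suc (trans (count-≢ proj₁ {d = p′ , q′} {D₁} (≢-sym p≢p′)) c)))))
  with (_ , r′) , D₃ , refl , perm₃ ← count-pos proj₁ {p′} {D₂} (n≢0⇒n>0 λ c → ≢1′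
    (trans (count-↭ proj₁ perm₁) (trans (count-≢ proj₁ p≢p′) (trans (count-≡ proj₁ {d = p′ , q′} {D₁} refl)
      (cong suc (trans (count-↭ proj₁ perm₂) (trans (count-≢ proj₁ p≢p′) c))))))) =
  r , r′ , D₃ , ↭-trans perm₁ (↭-prep _ (↭-prep _ (↭-trans perm₂ (↭-prep _ perm₃))))

-- Two disjoint demands are joined by a second demand from each of their rows. The four can be
-- ordered suitably unless three of them share a column.
quad : {D : Demands N} → 1 ≤ length D → (∀ a → rdeg D a < length D) → (∀ x → cdeg D x < length D) →
  (∀ a → rdeg D a ≢ 1) → (∀ x → cdeg D x ≢ 1) → Quad D
quad {D = D} pos rows< cols< rows cols
  with p , q , p′ , q′ , D₁ , perm₁ , p≢p′ , q≢q′ ← disjoint-pair {D = D} pos rows< cols<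
  with r , r′ , D₃ , perm ← two-rows perm₁ p≢p′ (rows p) (rows p′)
  with r ≟ r′ | r ≟ q | r ≟ q′
... | no r≢r′  | _        | _        = p , q , p′ , r′ , p , r , p′ , q′ , D₃ ,
  ↭-trans perm (↭-prep _ (↭-trans (↭-prep _ (↭.swap _ _ ↭-refl))
    (↭-trans (↭.swap _ _ ↭-refl) (↭-prep _ (↭.swap _ _ ↭-refl))))) , p≢p′ , p≢p′ , q≢q′ , ≢-sym r≢r′
... | yes refl | yes refl | _        = quad-column {D = D} cols p≢p′ q≢q′ perm
... | yes refl | no _     | yes refl = quad-column {D = D} cols (≢-sym p≢p′) (≢-sym q≢q′)
  (↭-trans perm (↭-trans (↭.swap _ _ ↭-refl) (↭-prep _ (↭-prep _ (↭.swap _ _ ↭-refl)))))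
... | yes refl | no r≢q   | no r≢q′  = p , q , p′ , q′ , p , r , p′ , r , D₃ , perm ,
  p≢p′ , p≢p′ , ≢-sym r≢q , ≢-sym r≢q′

-- Degree sums and vertices of small degree

n+n≡n*2 : ∀ n → n + n ≡ n * 2
n+n≡n*2 = solve-∀

module _ {A : Set} (f : A → ℕ) where

  sum-map-≥ : ∀ {m Vs} → All (λ v → m ≤ f v) Vs → length Vs * m ≤ sum (map f Vs)
  sum-map-≥ []       = z≤n
  sum-map-≥ (p ∷ ps) = +-mono-≤ p (sum-map-≥ ps)

  sum-map-tight : ∀ {m Vs} → All (λ v → m ≤ f v) Vs → sum (map f Vs) ≤ length Vs * m → All (λ v → f v ≡ m) Vs
  sum-map-tight []       _ = []
  sum-map-tight {m} {v ∷ Vs} (p ∷ ps) s =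
    ≤-antisym (+-cancelʳ-≤ (length Vs * m) _ _ (≤-trans (+-monoʳ-≤ (f v) (sum-map-≥ ps)) s)) p ∷
    sum-map-tight ps (+-cancelˡ-≤ m _ _ (≤-trans (+-monoˡ-≤ _ p) s))

  HasZero TwoOnes : List A → Set
  HasZero Vs = ∃₂ λ v Vs′ → f v ≡ 0 × Vs ↭ v ∷ Vs′
  TwoOnes Vs = ∃₂ λ v v′ → ∃ λ Vs′ → f v ≡ 1 × f v′ ≡ 1 × Vs ↭ v ∷ v′ ∷ Vs′

  data Zeros (Vs : List A) : Set where
    one : ∀ {v Vs′} → Vs ↭ v ∷ Vs′ → f v ≡ 0 → All (λ v → f v ≡ 2) Vs′ → Zeros Vs
    two : ∀ {v v′ Vs′} → Vs ↭ v ∷ v′ ∷ Vs′ → f v ≡ 0 → f v′ ≡ 0 → Zeros Vs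

  ≥2 : ∀ {Vs} → All (λ v → f v ≢ 0) Vs → All (λ v → f v ≢ 1) Vs → All (λ v → 2 ≤ f v) Vs
  ≥2 ≢0 ≢1 = All.zipWith (λ (p , q) → ≤∧≢⇒< (n≢0⇒n>0 p) (≢-sym q)) (≢0 , ≢1)

  rest-sum : ∀ {n Vs v Vs′} → length Vs ≡ n → 2 + sum (map f Vs) ≡ n + n → Vs ↭ v ∷ Vs′ →
    f v + sum (map f Vs′) ≡ length Vs′ * 2
  rest-sum {Vs = Vs} {v} {Vs′} refl total perm = +-cancelˡ-≡ 2 _ _ (begin
    2 + sum (map f (v ∷ Vs′))  ≡⟨ cong (2 +_) (sum-↭ (↭-map⁺ f perm)) ⟨
    2 + sum (map f Vs)         ≡⟨ total ⟩
    length Vs + length Vs      ≡⟨ n+n≡n*2 (length Vs) ⟩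
    length Vs * 2              ≡⟨ cong (_* 2) (↭-length perm) ⟩
    2 + length Vs′ * 2         ∎)
    where open ≡-Reasoning

  -- A single 1 among values of at least 2 would already give the sum 2n - 1.
  light : ∀ {n Vs} → length Vs ≡ n → 2 + sum (map f Vs) ≡ n + n → HasZero Vs ⊎ TwoOnes Vs
  light {n} {Vs} len total with extract (λ v → f v ℕ.≟ 0) Vs
  ... | inj₁ (v , Vs′ , z , perm) = inj₁ (v , Vs′ , z , perm)
  ... | inj₂ ≢0 with extract (λ v → f v ℕ.≟ 1) Vs
  ...   | inj₂ ≢1 = ⊥-elim (1+n≰n (begin
    1 + length Vs * 2        ≤⟨ n≤1+n _ ⟩
    2 + length Vs * 2        ≤⟨ s≤s (s≤s (sum-map-≥ (≥2 ≢0 ≢1))) ⟩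
    2 + sum (map f Vs)       ≡⟨ total ⟩
    n + n                    ≡⟨ n+n≡n*2 n ⟩
    n * 2                    ≡⟨ cong (_* 2) len ⟨
    length Vs * 2            ∎))
    where open ≤-Reasoning
  ...   | inj₁ (v , Vs₁ , o , perm) with extract (λ v → f v ℕ.≟ 1) Vs₁
  ...     | inj₁ (v′ , Vs₂ , o′ , perm′) = inj₂ (v , v′ , Vs₂ , o , o′ , ↭-trans perm (↭-prep v perm′))
  ...     | inj₂ ≢1 = ⊥-elim (1+n≰n (begin
    1 + length Vs₁ * 2       ≤⟨ s≤s (sum-map-≥ (≥2 (All.tail (All-resp-↭ perm ≢0)) ≢1)) ⟩
    1 + sum (map f Vs₁)      ≡⟨ cong (_+ sum (map f Vs₁)) o ⟨
    f v + sum (map f Vs₁)    ≡⟨ rest-sum len total perm ⟩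
    length Vs₁ * 2           ∎))
    where open ≤-Reasoning

  -- If there is only one zero, the other n - 1 values are at least 2 and sum to 2(n - 1), so all of
  -- them equal 2.
  zeros : ∀ {n Vs} → length Vs ≡ n → 2 + sum (map f Vs) ≡ n + n → All (λ v → f v ≢ 1) Vs →
    HasZero Vs → Zeros Vs
  zeros len total ≢1 (v , Vs₁ , z , perm) with extract (λ v → f v ℕ.≟ 0) Vs₁
  ... | inj₁ (v′ , Vs₂ , z′ , perm′) = two (↭-trans perm (↭-prep v perm′)) z z′
  ... | inj₂ ≢0 = one perm z (sum-map-tight (≥2 ≢0 (All.tail (All-resp-↭ perm ≢1)))
    (≤-reflexive (trans (cong (_+ sum (map f Vs₁)) (sym z)) (rest-sum len total perm))))

-- Reductions at a vertex of degree 1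

module _ {n} {As Bs : List (Fin N)} {D} (I : Instance n As Bs D) where

  open Instance I

  row-total : 2 + sum (map (rdeg D) As) ≡ n + n
  row-total = trans (cong (2 +_) (sum-count proj₁ unA (All.map proj₁ box))) total

  column-total : 2 + sum (map (cdeg D) Bs) ≡ n + n
  column-total = trans (cong (2 +_) (sum-count proj₂ unB (All.map proj₂ box))) total

  order<size : 3 ≤ n → n < length D
  order<size 3≤n = +-cancelˡ-≤ 2 _ _ (≤-trans (+-monoˡ-≤ n 3≤n) (≤-reflexive (sym total)))

-- The corner routing needs a demand outside the column of the demand at `a`; it exists because
-- there are more demands than one column can hold.
resolve-pendant : ∀ {k} → 4 ≤ k → Solvable k → ∀ {a b} {As Bs : List (Fin N)} {D} →
  Instance (suc k) (a ∷ As) (b ∷ Bs) D → rdeg D a ≡ 1 → cdeg D b ≡ 0 →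
  Routed (Box (a ∷ As) (b ∷ Bs)) D
resolve-pendant 4≤k IH {a} {b} {D = D} I da db
  with (_ , x) , D₁ , refl , p₁ ← count-pos proj₁ {a} {D} (≤-reflexive (sym da))
  with extract (λ e → ¬? (x ≟ proj₂ e)) D₁
... | inj₂ none = ⊥-elim (<⇒≱ (order<size I (m≤n⇒m≤1+n (≤-trans (n≤1+n 3) 4≤k))) (begin
    length D   ≡⟨ trans (↭-length p₁) (sym (count-all proj₂ {x} (refl ∷ All.map (sym ∘ decidable-stable (x ≟ _)) none))) ⟩
    cdeg ((a , x) ∷ D₁) x  ≡⟨ count-↭ proj₂ p₁ ⟨
    cdeg D x   ≤⟨ Instance.cols I x ⟩
    _          ∎))
  where open ≤-Reasoning
... | inj₁ (_ , D₂ , x≢x′ , p₂) = routed-↭ ↭-refl ↭-refl p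
  (resolve-corner 4≤k IH (instance-↭ ↭-refl ↭-refl p I)
    (All.tail (All-resp-↭ p₂ (count-zero proj₁ (count-rest-≡ proj₁ p₁ refl da))))
    (All-resp-↭ p (count-zero proj₂ db)) x≢x′)
  where p = ↭-trans p₁ (↭-prep _ p₂)

pull : {x : X} {xs : List X} → x ∈ xs → ∃ λ ys → xs ↭ x ∷ ys
pull {x = x} x∈ with ys , zs , refl ← ∈-∃++ x∈ = ys ++ zs , shift x ys zs

pull₂ : {x y : X} {xs : List X} → x ∈ xs → y ∈ xs → x ≢ y → ∃ λ ys → xs ↭ x ∷ y ∷ ys
pull₂ x∈ y∈ x≢y with ys , p ← pull x∈ with ∈-resp-↭ p y∈
... | here eq   = ⊥-elim (x≢y (sym eq))
... | there y∈′ = let zs , p′ = pull y∈′ in zs , ↭-trans p (↭-prep _ p′)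

-- What is left once vertices of degree 1 are dealt with. It is kept separate because order 5
-- settles it by search and larger orders by deleting vertices.
ZeroCase : ℕ → Set₁
ZeroCase n = ∀ {N} {As Bs : List (Fin N)} {D} → Instance n As Bs D →
  (∀ a → rdeg D a ≢ 1) → (∀ x → cdeg D x ≢ 1) →
  HasZero (rdeg D) As → HasZero (cdeg D) Bs → Routed (Box As Bs) D

resolve-pendantʳ : ∀ {k} → 4 ≤ k → Solvable k → ∀ {a b} {As Bs : List (Fin N)} {D} →
  Instance (suc k) (a ∷ As) (b ∷ Bs) D → rdeg D a ≡ 0 → cdeg D b ≡ 1 →
  Routed (Box (a ∷ As) (b ∷ Bs)) D
resolve-pendantʳ 4≤k IH {a} {b} {D = D} I da db = routed-swap
  (resolve-pendant 4≤k IH (instance-swap I)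
    (trans (count-map proj₁ swap b D) db) (trans (count-map proj₂ swap a D) da))

solvable-step : ∀ {k} → 4 ≤ k → Solvable k → ZeroCase (suc k) → Solvable (suc k)
solvable-step {k} 4≤k IH zeroCase {As = As} {Bs} {D} I
  with light (rdeg D) (Instance.lenA I) (row-total I) | light (cdeg D) (Instance.lenB I) (column-total I)
... | inj₂ (a , _ , As′ , da , _ , pA) | inj₁ (b , Bs′ , db , pB) =
  routed-↭ pA pB ↭-refl (resolve-pendant 4≤k IH (instance-↭ pA pB ↭-refl I) da db)
... | inj₁ (a , As′ , da , pA) | inj₂ (b , _ , Bs′ , db , _ , pB) =
  routed-↭ pA pB ↭-refl (resolve-pendantʳ 4≤k IH (instance-↭ pA pB ↭-refl I) da db)
... | inj₂ (a , _ , As′ , da , _ , pA) | inj₂ (b , b′ , Bs′ , db , db′ , pB) with (a , b) ∈? D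
...   | no ab∉ = routed-↭ pA pB ↭-refl (resolve-leaves 4≤k IH (instance-↭ pA pB ↭-refl I) da db ab∉)
-- Here the second vertex of degree 1 takes the place of `b`.
...   | yes ab∈ = routed-↭ pA pB′ ↭-refl (resolve-leaves 4≤k IH (instance-↭ pA pB′ ↭-refl I) da db′ ab′∉)
  where
  pB′ = ↭-trans pB (↭.swap b b′ ↭-refl)
  b≢b′ : b ≢ b′
  b≢b′ = All.head (AllPairs.head (unique-↭ pB (Instance.unB I)))
  -- The only demand at a is (a , b).
  ab′∉ : (a , b′) ∉ D
  ab′∉ ab′∈ with D′ , p ← pull₂ ab∈ ab′∈ (by-col b≢b′) = 1+n≢0 (suc-injective (begin
    suc (suc (rdeg D′ a))              ≡⟨ cong suc (count-≡ proj₁ {d = a , b′} {D′} refl) ⟨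
    suc (rdeg ((a , b′) ∷ D′) a)       ≡⟨ count-≡ proj₁ {d = a , b} {(a , b′) ∷ D′} refl ⟨
    rdeg ((a , b) ∷ (a , b′) ∷ D′) a   ≡⟨ count-↭ proj₁ p ⟨
    rdeg D a                           ≡⟨ da ⟩
    1                                  ∎))
    where open ≡-Reasoning
solvable-step {k} 4≤k IH zeroCase {As = As} {Bs} {D} I | inj₁ za@(a , _ , da , pA) | inj₁ zb@(b , _ , db , pB)
  with extract (λ v → rdeg D v ℕ.≟ 1) As | extract (λ w → cdeg D w ℕ.≟ 1) Bs
... | inj₁ (_ , _ , da′ , pA′) | _ =
  routed-↭ pA′ pB ↭-refl (resolve-pendant 4≤k IH (instance-↭ pA′ pB ↭-refl I) da′ db)
... | inj₂ _ | inj₁ (_ , _ , db′ , pB′) =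
  routed-↭ pA pB′ ↭-refl (resolve-pendantʳ 4≤k IH (instance-↭ pA pB′ ↭-refl I) da db′)
... | inj₂ noA | inj₂ noB = zeroCase I
  (count-avoid proj₁ noA (All.map proj₁ (Instance.box I)))
  (count-avoid proj₂ noB (All.map proj₂ (Instance.box I))) za zb
  where
  count-avoid : (key : Edge (Fin _) → Fin _) {Vs : List (Fin _)} → All (λ v → count key v D ≢ 1) Vs →
    All (λ e → key e ∈ Vs) D → ∀ v → count key v D ≢ 1
  count-avoid key {Vs} none keys v eq with mem? _≟_ v Vs
  ... | yes v∈ = All.lookup none v∈ eq
  ... | no v∉  = 1+n≢0 (trans (sym eq) (count-absent key (All.map (λ { v∈ refl → v∉ v∈ }) keys)))

-- The orders settled by search

ok₅-intro : ∀ {d} → d ≤ 5 → d ≢ 1 → T (ok₅ d)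
ok₅-intro {d} d≤5 d≢1 = from T-∧ (≤⇒≤ᵇ d≤5 , not-one d d≢1)
  where
  not-one : ∀ d → d ≢ 1 → T (not (d ≡ᵇ 1))
  not-one 0             _  = _
  not-one 1             ≢1 = ≢1 refl
  not-one (suc (suc _)) _  = _

solvable₄ : Solvable 4
solvable₄ I₀ = routed-↭ p q ↭-refl
  (base ok₄ 4 6 check₄ I₀.lenA I₀.lenB I.unA I.lenA I.unB I.lenB I₀.box (+-cancelˡ-≡ 2 _ _ I.total)
    (All.universal (λ a → ≤⇒≤ᵇ (I.rows a)) _) (All.universal (λ x → ≤⇒≤ᵇ (I.cols x)) _))
  where
  p = ↭-sym (↭-reflexive (++-identityʳ _))
  q = ↭-sym (↭-reflexive (++-identityʳ _))
  module I₀ = Instance I₀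
  module I = Instance (instance-↭ p q ↭-refl I₀)

-- The isolated vertices are rotated to the last position, so the demands occupy the four positions
-- that the search covers.
zero-case₅ : ZeroCase 5
zero-case₅ {D = D} I₀ rows≢1 cols≢1 (a , As , da , p) (b , Bs , db , q) = routed-↭ p′ q′ ↭-refl
  (base ok₅ 5 8 check₅ (suc-injective I₁.lenA) (suc-injective I₁.lenB) I.unA I.lenA I.unB I.lenB
    (box-tail I₁.box (count-zero proj₁ da) (count-zero proj₂ db)) (+-cancelˡ-≡ 2 _ _ I.total)
    (All.universal (λ a → ok₅-intro {rdeg D a} (I.rows a) (rows≢1 a)) _)
    (All.universal (λ x → ok₅-intro {cdeg D x} (I.cols x) (cols≢1 x)) _))
  where
  p′ = ↭-trans p (∷↭∷ʳ a As)
  q′ = ↭-trans q (∷↭∷ʳ b Bs)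
  module I₁ = Instance (instance-↭ p q ↭-refl I₀)
  module I = Instance (instance-↭ p′ q′ ↭-refl I₀)

-- Larger orders without vertices of degree 1

count-two-rows : {D : Demands N} → ∀ {p q p′ q′ r r′ D₃} → D ↭ (p , q) ∷ (p′ , q′) ∷ (p , r) ∷ (p′ , r′) ∷ D₃ →
  p ≢ p′ → rdeg D p ≡ 2 → All (λ e → proj₁ e ≢ p) D₃
count-two-rows {D = D} {p} {q} {p′} {q′} {r} {r′} {D₃} perm p≢p′ c =
  count-zero proj₁ (suc-injective (suc-injective (begin
    2 + rdeg D₃ p                            ≡⟨ cong (2 +_) (count-≢ proj₁ {d = p′ , r′} {D₃} (≢-sym p≢p′)) ⟨
    2 + rdeg ((p′ , r′) ∷ D₃) p              ≡⟨ cong suc (count-≡ proj₁ {d = p , r} {(p′ , r′) ∷ D₃} refl) ⟨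
    1 + rdeg D₂ p                            ≡⟨ cong suc (count-≢ proj₁ {d = p′ , q′} {D₂} (≢-sym p≢p′)) ⟨
    1 + rdeg ((p′ , q′) ∷ D₂) p              ≡⟨ count-≡ proj₁ {d = p , q} {(p′ , q′) ∷ D₂} refl ⟨
    rdeg ((p , q) ∷ (p′ , q′) ∷ D₂) p        ≡⟨ count-↭ proj₁ perm ⟨
    rdeg D p                                 ≡⟨ c ⟩
    2                                        ∎)))
  where
  open ≡-Reasoning
  D₂ = (p , r) ∷ (p′ , r′) ∷ D₃

zeros-zero : ∀ {f : Fin N → ℕ} {Vs} → Zeros f Vs → HasZero f Vs
zeros-zero (one p z _)  = _ , _ , z , p
zeros-zero (two p z _) = _ , _ , z , p

resolve-simple-row : ∀ {k} → 4 ≤ k → Solvable k → ∀ {As Bs : List (Fin N)} {D} → Instance (suc k) As Bs D →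
  ∀ {p q p′ q′ r r′ D₃} → D ↭ (p , q) ∷ (p′ , q′) ∷ (p , r) ∷ (p′ , r′) ∷ D₃ →
  p ≢ p′ → rdeg D p ≡ 2 → q ≢ r → HasZero (cdeg D) Bs → Routed (Box As Bs) D
resolve-simple-row 4≤k IH {D = D} I {p} {q} {p′} {q′} {r} {r′} perm p≢p′ c q≢r (b , Bs′ , db , pB)
  with As′ , pA ← pull (proj₁ (All.lookup (Instance.box I) (∈-resp-↭ (↭-sym perm) (here refl)))) =
  routed-↭ pA pB perm′ (resolve-corner 4≤k IH (instance-↭ pA pB perm′ I)
    (≢-sym p≢p′ ∷ ≢-sym p≢p′ ∷ count-two-rows perm p≢p′ c) (All-resp-↭ perm′ (count-zero proj₂ db)) q≢r)
  where
  perm′ : D ↭ (p , q) ∷ (p , r) ∷ (p′ , q′) ∷ (p′ , r′) ∷ _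
  perm′ = ↭-trans perm (↭-prep _ (↭.swap _ _ ↭-refl))

degree-two : (key : X → Fin N) → ∀ {v₀ Vs Vs₁ D} → Vs ↭ v₀ ∷ Vs₁ → count key v₀ D ≡ 0 →
  All (λ v → count key v D ≡ 2) Vs₁ → ∀ {d} → d ∈ D → key d ∈ Vs → count key (key d) D ≡ 2
degree-two key {D = D} perm zero₀ all2 d∈ v∈ with ∈-resp-↭ perm v∈
... | here eq  = ⊥-elim (All.lookup (count-zero key {D = D} zero₀) d∈ eq)
... | there v∈ = All.lookup all2 v∈

-- Two isolated columns are deleted and serve as detours. If there is only one, every other column
-- has degree 2, so `q` and `q′` are exhausted by the four demands and are deleted themselves.
resolve-double-rows : ∀ {k} → 4 ≤ k → Solvable k → ∀ {As Bs : List (Fin N)} {D} →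
  Instance (2 + k) As Bs D →
  ∀ {p q p′ q′ D₃} → D ↭ (p , q) ∷ (p , q) ∷ (p′ , q′) ∷ (p′ , q′) ∷ D₃ → p ≢ p′ → q ≢ q′ →
  All (λ e → proj₁ e ≢ p) D₃ → All (λ e → proj₁ e ≢ p′) D₃ →
  Zeros (cdeg D) Bs → Routed (Box As Bs) D
resolve-double-rows {k = k} 4≤k IH {Bs = Bs} {D} I {p} {q} {p′} {q′} {D₃} perm p≢p′ q≢q′ D₃≢p D₃≢p′ zs
  with (p∈ , q∈) ∷ _ ∷ (p′∈ , q′∈) ∷ _ ∷ _ ← All-resp-↭ perm (Instance.box I)
  with As′ , pA ← pull₂ p∈ p′∈ p≢p′
  with zs
... | two {b} {b′} {Bs′} pB zb zb′
  with q≢b  ∷ _ ∷ q′≢b  ∷ _ ∷ D₃≢b  ← All-resp-↭ perm (count-zero proj₂ {b} {D} zb)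
     | q≢b′ ∷ _ ∷ q′≢b′ ∷ _ ∷ D₃≢b′ ← All-resp-↭ perm (count-zero proj₂ {b′} {D} zb′) =
  routed-↭ pA pB perm (resolve-doubles 4≤k IH I′ D₃≢p D₃≢p′ D₃≢b D₃≢b′ q≢q′
    (here refl) (there (here refl)) (All.head (AllPairs.head I′.unB)) (≢-sym q≢b) (≢-sym q′≢b) (≢-sym q≢b′) (≢-sym q′≢b′)
    (λ { w∈ (here eq) → here eq
       ; w∈ (there (here eq)) → there (here eq)
       ; w∈ (there (there w∈′)) → ⊥-elim (unique-++-disjoint (b ∷ b′ ∷ []) I′.unB w∈′ w∈) })
    (inj₁ (↭-prep q (↭.swap q q′ ↭-refl))))
  where
  I′ = instance-↭ pA pB perm I
  module I′ = Instance I′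
... | one {y} {Bs₁} pB₀ zy all2
  with Bs′ , pB ← pull₂ q∈ q′∈ q≢q′
     | y′ , y′∈ , y′∉ ← fresh {xs = y ∷ q ∷ q′ ∷ []} (Instance.unB I)
         (≤-trans 4≤k (≤-trans (m≤n+m k 2) (≤-reflexive (sym (Instance.lenB I)))))
     | y≢q ∷ _ ∷ y≢q′ ∷ _ ← All.map ≢-sym (All-resp-↭ perm (count-zero proj₂ {y} {D} zy)) =
  routed-↭ pA pB perm (resolve-doubles 4≤k IH (instance-↭ pA pB perm I) D₃≢p D₃≢p′
    (count-zero proj₂ D₃-q) (count-zero proj₂ D₃-q′) q≢q′
    (∈-resp-↭ (↭-trans (↭-sym pB₀) pB) (here refl)) (∈-resp-↭ pB y′∈)
    (λ eq → y′∉ (here (sym eq))) y≢q y≢q′ (y′∉ ∘ there ∘ here) (y′∉ ∘ there ∘ there ∘ here)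
    (λ { w∈ (here refl) → ⊥-elim (unique-++-disjoint (q ∷ q′ ∷ []) unB′ (here refl) w∈)
       ; w∈ (there (here refl)) → ⊥-elim (unique-++-disjoint (q ∷ q′ ∷ []) unB′ (there (here refl)) w∈)
       ; w∈ (there (there w∈′)) → w∈′ })
    -- The detour columns `y` and `y′` are not ends of deleted demands, so the accounting of ends
    -- gives way to the bound 2 on all remaining column degrees.
    (inj₂ λ {w} w∈ → ≤-trans (D₃≤2 w (∈-resp-↭ (↭-trans (↭-sym pB) pB₀) (there (there w∈)))) (≤-trans (s≤s (s≤s z≤n)) 4≤k)))
  where
  unB′ = unique-↭ pB (Instance.unB I)
  cdeg-D : ∀ w → cdeg D w ≡ cdeg ((p , q) ∷ (p , q) ∷ (p′ , q′) ∷ (p′ , q′) ∷ D₃) w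
  cdeg-D w = count-↭ proj₂ perm
  D₃-q : cdeg D₃ q ≡ 0
  D₃-q = suc-injective (suc-injective (begin
    2 + cdeg D₃ q                                ≡⟨ cong (2 +_) (count-≢ proj₂ {d = p′ , q′} {D₃} (≢-sym q≢q′)) ⟨
    2 + cdeg ((p′ , q′) ∷ D₃) q                  ≡⟨ cong (2 +_) (count-≢ proj₂ {d = p′ , q′} {(p′ , q′) ∷ D₃} (≢-sym q≢q′)) ⟨
    2 + cdeg D₂ q                                ≡⟨ cong suc (count-≡ proj₂ {d = p , q} {D₂} refl) ⟨
    1 + cdeg ((p , q) ∷ D₂) q                    ≡⟨ count-≡ proj₂ {d = p , q} {(p , q) ∷ D₂} refl ⟨
    cdeg ((p , q) ∷ (p , q) ∷ D₂) q              ≡⟨ cdeg-D q ⟨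
    cdeg D q                                     ≡⟨ degree-two proj₂ pB₀ zy all2 (∈-resp-↭ (↭-sym perm) (here refl)) q∈ ⟩
    2                                            ∎))
    where
    open ≡-Reasoning
    D₂ = (p′ , q′) ∷ (p′ , q′) ∷ D₃
  D₃-q′ : cdeg D₃ q′ ≡ 0
  D₃-q′ = suc-injective (suc-injective (begin
    2 + cdeg D₃ q′                               ≡⟨ cong suc (count-≡ proj₂ {d = p′ , q′} {D₃} refl) ⟨
    1 + cdeg ((p′ , q′) ∷ D₃) q′                 ≡⟨ count-≡ proj₂ {d = p′ , q′} {(p′ , q′) ∷ D₃} refl ⟨
    cdeg D₂ q′                                   ≡⟨ count-≢ proj₂ {d = p , q} {D₂} q≢q′ ⟨
    cdeg ((p , q) ∷ D₂) q′                       ≡⟨ count-≢ proj₂ {d = p , q} {(p , q) ∷ D₂} q≢q′ ⟨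
    cdeg ((p , q) ∷ (p , q) ∷ D₂) q′             ≡⟨ cdeg-D q′ ⟨
    cdeg D q′                                    ≡⟨ degree-two proj₂ pB₀ zy all2
                                                      (∈-resp-↭ (↭-sym perm) (there (there (here refl)))) q′∈ ⟩
    2                                            ∎))
    where
    open ≡-Reasoning
    D₂ = (p′ , q′) ∷ (p′ , q′) ∷ D₃
  D₃≤D : ∀ w → cdeg D₃ w ≤ cdeg D w
  D₃≤D w = ≤-trans (m≤n+m _ (cdeg E w)) (≤-reflexive (sym (trans (cdeg-D w) (count-++ proj₂ E))))
    where E = (p , q) ∷ (p , q) ∷ (p′ , q′) ∷ (p′ , q′) ∷ []
  D₃≤2 : ∀ w → w ∈ y ∷ Bs₁ → cdeg D₃ w ≤ 2
  D₃≤2 w (here refl) = ≤-trans (D₃≤D w) (≤-trans (≤-reflexive zy) z≤n)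
  D₃≤2 w (there w∈)  = ≤-trans (D₃≤D w) (≤-reflexive (All.lookup all2 w∈))

-- Both rows of a disjoint pair have degree 2. Either one of them meets two columns, and `IH₁`
-- applies after a corner routing, or both carry double demands.
resolve-one-zero : ∀ {k} → 4 ≤ k → Solvable k → Solvable (suc k) → ∀ {a₀} {As As₁ Bs : List (Fin N)} {D} →
  Instance (2 + k) As Bs D → As ↭ a₀ ∷ As₁ → rdeg D a₀ ≡ 0 → All (λ a → rdeg D a ≡ 2) As₁ →
  Zeros (cdeg D) Bs → Routed (Box As Bs) D
resolve-one-zero {k = k} 4≤k IH IH₁ {a₀} {As} {As₁} {Bs} {D} I pA₀ da₀ all2 zs
  with size ← order<size I (s≤s (s≤s (≤-trans (s≤s z≤n) 4≤k)))
  with p , q , p′ , q′ , D₁ , perm₁ , p≢p′ , q≢q′ ← disjoint-pair {D = D} (≤-trans (s≤s z≤n) size)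
         (λ a → ≤-trans (s≤s (Instance.rows I a)) size) (λ x → ≤-trans (s≤s (Instance.cols I x)) size)
  with cp  ← degree-two proj₁ pA₀ da₀ all2 (∈-resp-↭ (↭-sym perm₁) (here refl))
               (proj₁ (All.head (All-resp-↭ perm₁ (Instance.box I))))
     | cp′ ← degree-two proj₁ pA₀ da₀ all2 (∈-resp-↭ (↭-sym perm₁) (there (here refl)))
               (proj₁ (All.head (All.tail (All-resp-↭ perm₁ (Instance.box I)))))
  with r , r′ , D₃ , perm ← two-rows perm₁ p≢p′ (λ c → case trans (sym cp) c of λ ()) (λ c → case trans (sym cp′) c of λ ())
  with perm′ ← ↭-trans perm (↭-trans (↭.swap _ _ ↭-refl) (↭-prep _ (↭-prep _ (↭.swap _ _ ↭-refl))))
  with q ≟ r | q′ ≟ r′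
... | no q≢r | _ = resolve-simple-row (m≤n⇒m≤1+n 4≤k) IH₁ I perm p≢p′ cp q≢r (zeros-zero zs)
... | yes _ | no q′≢r′ = resolve-simple-row (m≤n⇒m≤1+n 4≤k) IH₁ I perm′ (≢-sym p≢p′) cp′ q′≢r′ (zeros-zero zs)
... | yes refl | yes refl = resolve-double-rows 4≤k IH I (↭-trans perm (↭-prep _ (↭.swap _ _ ↭-refl))) p≢p′ q≢q′
  (count-two-rows perm p≢p′ cp) (count-two-rows perm′ (≢-sym p≢p′) cp′) zs

zeros-cong : ∀ {f g : Fin N → ℕ} {Vs} → (∀ v → f v ≡ g v) → Zeros f Vs → Zeros g Vs
zeros-cong eq (one p z all2) = one p (trans (sym (eq _)) z) (All.map (trans (sym (eq _))) all2)
zeros-cong eq (two p z z′)   = two p (trans (sym (eq _)) z) (trans (sym (eq _)) z′)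

zero-case : ∀ {k} → 4 ≤ k → Solvable k → Solvable (suc k) → ZeroCase (2 + k)
zero-case {k} 4≤k IH IH₁ {As = As} {Bs} {D} I rows≢1 cols≢1 za zb
  with zeros (rdeg D) (Instance.lenA I) (row-total I) (All.universal rows≢1 As) za
     | zeros (cdeg D) (Instance.lenB I) (column-total I) (All.universal cols≢1 Bs) zb
... | one pA z all2 | zs = resolve-one-zero 4≤k IH IH₁ I pA z all2 zs
... | zs@(two _ _ _) | one pB z all2 = routed-swap (resolve-one-zero 4≤k IH IH₁ (instance-swap I) pB
  (trans (count-map proj₁ swap _ D) z) (All.map (trans (count-map proj₁ swap _ D)) all2)
  (zeros-cong (λ v → sym (count-map proj₂ swap v D)) zs))
... | two {a} {a′} pA z z′ | two {b} {b′} pB w w′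
  with size ← order<size I (s≤s (s≤s (≤-trans (s≤s z≤n) 4≤k)))
  with _ , _ , _ , _ , _ , _ , _ , _ , _ , perm , p₁≢p₂ , p₃≢p₄ , x₁≢x₄ , x₂≢x₃ ←
    quad {D = D} (≤-trans (s≤s z≤n) size) (λ a → ≤-trans (s≤s (Instance.rows I a)) size)
         (λ x → ≤-trans (s≤s (Instance.cols I x)) size) rows≢1 cols≢1 =
  routed-↭ pA pB perm (resolve-quad 4≤k IH (instance-↭ pA pB perm I)
    (All-resp-↭ perm (count-zero proj₁ z)) (All-resp-↭ perm (count-zero proj₁ z′))
    (All-resp-↭ perm (count-zero proj₂ w)) (All-resp-↭ perm (count-zero proj₂ w′)) p₁≢p₂ p₃≢p₄ x₁≢x₄ x₂≢x₃)

-- The induction and the padding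

solvable : ∀ m → Solvable (4 + m)
solvable 0             = solvable₄
solvable 1             = solvable-step ≤-refl solvable₄ zero-case₅
solvable (suc (suc m)) = solvable-step (≤-trans (m≤m+n 4 m) (n≤1+n _)) (solvable (suc m))
  (zero-case (m≤m+n 4 m) (solvable m) (solvable (suc m)))

light-vertex : (key : X → Fin N) (D : List X) → 2 + length D ≤ N + N → ∃ λ v → count key v D ≤ 1
light-vertex {N = N} key D size with extract (λ v → count key v D ≤? 1) (allFin N)
... | inj₁ (v , _ , c≤1 , _) = v , c≤1
... | inj₂ none = ⊥-elim (1+n≰n (begin
    1 + length D                             ≤⟨ n≤1+n _ ⟩
    2 + length D                             ≤⟨ size ⟩
    N + N                                    ≡⟨ n+n≡n*2 N ⟩
    N * 2                                    ≡⟨ cong (_* 2) (length-tabulate {n = N} id) ⟨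
    length (allFin N) * 2                    ≤⟨ sum-map-≥ (λ v → count key v D) (All.map ≰⇒> none) ⟩
    sum (map (λ v → count key v D) (allFin N))
      ≡⟨ sum-count key (allFin⁺ N) (All.universal (λ d → ∈-allFin (key d)) D) ⟩
    length D                                 ∎))
  where open ≤-Reasoning

count-∷-bounded : (key : X → Fin N) (d : X) (D : List X) {n : ℕ} → 2 ≤ n → count key (key d) D ≤ 1 →
  (∀ v → count key v D ≤ n) → ∀ v → count key v (d ∷ D) ≤ n
count-∷-bounded key d D 2≤n light bound v with key d ≟ v
... | yes refl = ≤-trans (s≤s light) 2≤n
... | no  _    = bound v

-- Demands are added at vertices of degree at most 1 until there are exactly 2n - 2.
routed-all : Solvable N → 2 ≤ N → ∀ m (D : Demands N) → m + (2 + length D) ≡ N + N →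
  (∀ a → rdeg D a ≤ N) → (∀ x → cdeg D x ≤ N) → Routed (Box (allFin N) (allFin N)) D
routed-all {N} solve 2≤N zero D total rows cols = solve record
  { unA = allFin⁺ N ; unB = allFin⁺ N ; lenA = length-tabulate id ; lenB = length-tabulate id
  ; box = All.universal (λ _ → ∈-allFin _ , ∈-allFin _) D ; total = total ; rows = rows ; cols = cols }
routed-all {N} solve 2≤N (suc m) D total rows cols
  with size ← ≤-trans (m≤n+m (2 + length D) (suc m)) (≤-reflexive total)
  with a , a≤1 ← light-vertex proj₁ D size | x , x≤1 ← light-vertex proj₂ D size
  -- The trail of the added demand is discarded; the degrees at `a` and `x` have risen to at most 2.
  with _ ∷ r ← routed-all solve 2≤N m ((a , x) ∷ D) (trans (+-suc m _) total)
                 (count-∷-bounded proj₁ (a , x) D 2≤N a≤1 rows) (count-∷-bounded proj₂ (a , x) D 2≤N x≤1 cols) =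
  weaken proj₁ r

theorem3 : (n : ℕ) → 4 ≤ n → (D : Demand n) →
    length D ≤ 2 * n ∸ 2 → MaxDegLe D n → Resolvable D
theorem3 n 4≤n D len deg≤ = routed-resolvable D
  (routed-all (subst Solvable (m+[n∸m]≡n 4≤n) (solvable (n ∸ 4))) 2≤n (2 * n ∸ 2 ∸ length D) D total
    (deg≤ ∘ inj₁) (deg≤ ∘ inj₂))
  where
  2≤n : 2 ≤ n
  2≤n = ≤-trans (s≤s (s≤s z≤n)) 4≤n
  open ≡-Reasoning
  total : 2 * n ∸ 2 ∸ length D + (2 + length D) ≡ n + n
  total = begin
    2 * n ∸ 2 ∸ length D + (2 + length D)   ≡⟨ cong (2 * n ∸ 2 ∸ length D +_) (+-comm 2 (length D)) ⟩
    2 * n ∸ 2 ∸ length D + (length D + 2)   ≡⟨ +-assoc _ (length D) 2 ⟨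
    2 * n ∸ 2 ∸ length D + length D + 2     ≡⟨ cong (_+ 2) (m∸n+n≡m len) ⟩
    2 * n ∸ 2 + 2                           ≡⟨ m∸n+n≡m (≤-trans 2≤n (m≤m+n n _)) ⟩
    n + (n + 0)                             ≡⟨ cong (n +_) (+-identityʳ n) ⟩
    n + n                                   ∎
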